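{- Let $\mathcal{K}$ be a FUR-class with monster model $\mathbb{M}$. Let $a\in\mathbb{M}$ and let $A\subset\mathbb{M}$ be a finite set. Then $\mathrm{Cb}(a/A)\in\mathrm{bcl}(A)$ (bounded closure being taken in $\mathbb{M}^{eq}$).
   Context: SETTING. $(\mathcal{K},\preccurlyeq)$ is an abstract elementary class (AEC) with monster model $\mathbb{M}$: a $\delta$-model homogeneous and $\delta$-universal member of $\mathcal{K}$, $\delta$ a large cardinal. "Bounded" means of size $<\delta$. "Model" means $\mathcal{A}\in\mathcal{K}$, $\mathcal{A}\preccurlyeq\mathbb{M}$; models and parameter sets are bounded unless $\mathbb{M}$ itself is mentioned. $a\in X$ may be a finite tuple; juxtaposition denotes union or concatenation. TYPES. $\mathrm{Aut}(\mathbb{M}/A)$ is the group of automorphisms of $\mathbb{M}$ fixing $A$ pointwise. $a,b$ have the same Galois type over $A$, $t^g(a/A)=t^g(b/A)$, if $f(a)=b$ for some $f\in\mathrm{Aut}(\mathbb{M}/A)$; they have the same weak type, $t(a/A)=t(b/A)$, if $t^g(a/B)=t^g(b/B)$ for all finite $B\subseteq A$ (types of models are types of enumerations). For $A\subseteq B$ with $A$ finite, $t(a/B)$ splits over $A$ if there are $b,c\in B$ with $t(b/A)=t(c/A)$ but $t(ab/A)\ne t(ac/A)$. $a\downarrow^{ns}_B C$ means that $t(a/B\cup C)$ does not split over some finite $A\subseteq B$; $A\downarrow^{ns}_B C$ means $a\downarrow^{ns}_BC$ for each $a\in A$. $a\in\mathrm{bcl}(A)$ iff $t(a/A)$ has only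 boundedly many realizations. FUR-CLASS. $\mathcal{K}$ is a FUR-class if it has AP and JEP, $LS(\mathcal{K})=\omega$, has arbitrarily large structures, contains no finite models, and satisfies: (AI) Every countable model $\mathcal{A}$ is s-saturated: for any $b\in\mathbb{M}$ and finite $A\subseteq\mathcal{A}$ there is $a\in\mathcal{A}$ with $t(a/A)=t(b/A)$. (AII) For all $a$ and countable $\mathcal{A}$ there is an s-primary model $\mathcal{B}=\mathcal{A}a\cup\bigcup_{i<\omega}a_i$ over $\mathcal{A}a$. [s-primary: the $a_i$ are singletons and for all $n<\omega$ there is a finite $A_n\subset\mathcal{A}$ such that for all $(a',a_0',\dots,a_n')$ with $t(a'/\mathcal{A})=t(a/\mathcal{A})$: $t(a',a_0',\dots,a_n'/A_n)=t(a,a_0,\dots,a_n/A_n)$ implies $t(a',a_0',\dots,a_n'/\mathcal{A})=t(a,a_0,\dots,a_n/\mathcal{A})$.] (AIII) Let $\mathcal{A},\mathcal{B},\mathcal{C}$ be models with $\mathcal{A}\downarrow^{ns}_{\mathcal{B}}\mathcal{C}$ and $\mathcal{B}=\mathcal{A}\cap\mathcal{C}$. Then there is a unique (not only up to isomorphism) s-prime model $\mathcal{D}$ over $\mathcal{A}\cup\mathcal{C}$; furthermore, if $\mathcal{C}\subseteq\mathcal{C}'$ and $\mathcal{A}\downarrow^{ns}_{\mathcal{B}}\mathcal{C}'$, then $\mathcal{D}\downarrow^{ns}_{\mathcal{C}}\mathcal{C}'$. [For models $\mathcal{A}_i$, $i<\alpha$, and $A=\bigcup_{i<\alpha}\mathcal{A}_i$,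 a map $f:A\to\mathbb{M}$ is weakly elementary w.r.t. $(\mathcal{A}_i)_{i<\alpha}$ if $t(a/\emptyset)=t(f(a)/\emptyset)$ for all $a\in A$ and $f(\mathcal{A}_i)\preccurlyeq\mathbb{M}$ for all $i$. A model $\mathcal{D}$ is s-prime over $A$ if for every model $\mathcal{B}$ and every $f:A\to\mathcal{B}$ weakly elementary w.r.t. $(\mathcal{A}_i)_{i<\alpha}$ there is an elementary embedding $g:\mathcal{D}\to\mathcal{B}$ with $f\subseteq g$.] (AIV) For each $a\in\mathbb{M}$ there is $n<\omega$ such that for every countable model $\mathcal{A}$ and finite $A\subset\mathcal{A}$, player II has a winning strategy in $GI(a,A,\mathcal{A})$ in $n$ moves. [$GI(a,A,\mathcal{A})$: start with $a_0=a$, $A_0=A$. At move $n$, player I chooses $a_{n+1}\in\mathbb{M}$ and a finite $A_{n+1}'\subseteq\mathcal{A}$ with $t(a_{n+1}/A_n)=t(a_n/A_n)$, $A_n\subseteq A'_{n+1}$ and $t(a_{n+1}/A'_{n+1})\ne t(a_n/A'_{n+1})$; then player II chooses a finite $A_{n+1}\subseteq\mathcal{A}$ with $A'_{n+1}\subseteq A_{n+1}$. Player II wins if player I can no longer move.] (AV) If $\mathcal{A}\subseteq\mathcal{B}$ are countable models, $a\in\mathbb{M}$ and $\mathcal{B}\downarrow^{ns}_{\mathcal{A}}a$, then $a\downarrow^{ns}_{\mathcal{A}}\mathcal{B}$. (AVI) For all models $\mathcal{A},\mathcal{B},\mathcal{D}$ with $\mathcal{A}\subseteq\mathcal{B}\cap\mathcal{D}$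 there is a model $\mathcal{C}$ with $t(\mathcal{C}/\mathcal{A})=t(\mathcal{B}/\mathcal{A})$ and $\mathcal{C}\downarrow^{ns}_{\mathcal{A}}\mathcal{D}$. INDEPENDENCE. For finite $A$, $E(A)$ is the set of $\mathrm{Aut}(\mathbb{M}/A)$-invariant equivalence relations on powers $\mathbb{M}^n$ with boundedly many classes; $Lt(a/B)=Lt(b/B)$ means $(a,b)\in E$ for all finite $A\subseteq B$ and $E\in E(A)$. For $A\subseteq B$, $A$ finite, $t(a/B)$ Lascar splits over $A$ if there are $b,c\in B$ with $Lt(b/A)=Lt(c/A)$ and $t(ab/A)\neq t(ac/A)$. $a\downarrow_B C$ means: there is a finite $A\subseteq B$ such that for all $D\supseteq B\cup C$ there is $b$ with $t(b/B\cup C)=t(a/B\cup C)$ and $t(b/D)$ not Lascar splitting over $A$. IMAGINARIES. $\mathcal{E}$ is a countable collection of $\emptyset$-invariant equivalence relations $E\subseteq\mathbb{M}^n\times\mathbb{M}^n$ (various $n$), containing equality, each given by a countable collection $G_E$ of Galois types via $(a,b)\in E$ iff $t^g(ab/\emptyset)\in G_E$. $\mathbb{M}^{eq}=\{a/E:a\in\mathbb{M},E\in\mathcal{E}\}$, with $a$ identified with $a/{=}$, the structure of $\mathbb{M}$ on $P_=$, and predicates $P_E$ for $\{a/E:a\in\mathbb{M}\}$ and functions $F_E(a)=a/E$. All notions above also apply in $\mathbb{M}^{eq}$, with models $\mathcal{A}^{eq}=\{a/E:a\in\mathcal{A},E\in\mathcal{E}\}$. GLOBAL TYPES. The supermonster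 $\mathbb{M}'\in\mathcal{K}$ is a $|\mathbb{M}'|$-model homogeneous and universal structure with $\mathbb{M}\preccurlyeq\mathbb{M}'$ and $|\mathbb{M}'|>|\mathbb{M}|$. Types, Lascar types and independence for elements of $\mathbb{M}'$ are computed in $\mathbb{M}'$. A global type $p$ is a maximal collection $\{p_A:A\subset\mathbb{M}\text{ finite}\}$ such that $p_A$ is a Galois type over $A$, whenever $A\subseteq B$ and $b\in\mathbb{M}$ realizes $p_B$ then $b$ realizes $p_A$, and some single $b\in\mathbb{M}'$ realizes $p_A$ for every finite $A\subset\mathbb{M}$. For $f\in\mathrm{Aut}(\mathbb{M}^{eq})$, $f(p)=p$ means: for all finite $A,B\subset\mathbb{M}$ with $f(B)=A$ and all $b$ realizing $p_B$, $f(b)$ realizes $p_A$. $\alpha\in\mathbb{M}^{eq}$ is a canonical base for $p$ if for every $f\in\mathrm{Aut}(\mathbb{M}^{eq})$: $f(p)=p$ iff $f(\alpha)=\alpha$. For $a\in\mathbb{M}$ and $A\subset\mathbb{M}$, there is $b\in\mathbb{M}'$ with $Lt(b/A)=Lt(a/A)$ and $b\downarrow_A\mathbb{M}$; a canonical base for $a$ over $A$, written $\alpha=\mathrm{Cb}(a/A)$, is a canonical base of $t(b/\mathbb{M})$. STANDING CHOICE OF $\mathcal{E}$ (ensuring canonical bases exist in $\mathbb{M}^{eq}$). For a global type $p$ realized by $b\in\mathbb{M}'$ with $t(b/\mathbb{M})$ not splitting over a finite tuple $a\in\mathbb{M}$: for $c\in\mathbb{M}$ let $q_c=t(bc/\emptyset)$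 and let $q_i^c$, $i<\omega$, be types over $\emptyset$ such that for all $d\in\mathbb{M}$, $bd$ realizes $q_c$ iff $ad$ realizes some $q_i^c$. Let $(a_0,a_1)\in E$ iff for all $c,d\in\mathbb{M}$: $a_0d$ realizes some $q_i^c$ iff $a_1d$ realizes some $q_i^c$. These $E$ depend only on $t(ba/\emptyset)$; $\mathcal{E}$ contains all of them. -}

module Defs where

open import Data.Bool.Base using (Bool; if_then_else_)
open import Data.Fin.Base using (Fin; toℕ)
open import Data.List.Base using (List)
import Data.List.Base as List
open import Data.List.Relation.Unary.All using (All)
import Data.List.Membership.Setoid as Membership
open import Data.Maybe.Base using (Maybe; just; nothing)
open import Data.Nat.Base using (ℕ; zero; suc; _+_)
open import Data.Product.Base using (Σ; ∃; _×_; _,_; proj₁; proj₂)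
open import Data.Sum.Base using (_⊎_)
open import Data.Sum.Relation.Binary.Pointwise using (_⊎ₛ_)
open import Data.Vec.Functional using (Vector; _∷_; []; _++_; toList)
import Data.Vec.Functional.Relation.Binary.Equality.Setoid as VecEq
open import Function.Base using (_∘_)
open import Function.Bundles using (Func; Injection; _↣_; _⇔_)
open import Function.Definitions using (Congruent; Injective)
open import Function.Relation.Binary.Setoid.Equality using (_⇨_)
open import Induction.WellFounded using (WellFounded)
open import Level using (0ℓ)
open import Relation.Binary.Bundles using (Setoid)
open import Relation.Binary.Core using (Rel; _⇒_)
import Relation.Binary.Construct.On as On
open import Relation.Binary.PropositionalEquality.Core using (_≡_)
open import Relation.Binary.PropositionalEquality.Properties using (setoid)
open import Relation.Binary.Structures using (IsEquivalence; IsStrictTotalOrder)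
open import Relation.Nullary.Negation using (¬_)
open import Relation.Unary using (Pred; _∈_; _⊆_; _≐_; _∪_; _∩_; ∅; ⋃)

-- A set is a setoid, and a cardinal is represented by a set of that size.

infix 4 _≲_ _≺_

_≲_ : Setoid 0ℓ 0ℓ → Setoid 0ℓ 0ℓ → Set
X ≲ Y = Injection X Y

_≺_ : Setoid 0ℓ 0ℓ → Setoid 0ℓ 0ℓ → Set
X ≺ Y = X ≲ Y × ¬ (Y ≲ X)

sub : (X : Setoid 0ℓ 0ℓ) → Pred (Setoid.Carrier X) 0ℓ → Setoid 0ℓ 0ℓ
sub X P = On.setoid X (proj₁ {B = P})

ω : Setoid 0ℓ 0ℓ
ω = setoid ℕ

fibre : ∀ {X Y : Setoid 0ℓ 0ℓ} → Func X Y → Setoid.Carrier Y → Setoid 0ℓ 0ℓ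
fibre {X} {Y} f y = sub X (λ x → Setoid._≈_ Y (Func.to f x) y)

-- Regularity is phrased without ordinals: a set of size δ is not a union of
-- fewer than δ sets, each of size less than δ.
record StronglyInaccessible (δ : Setoid 0ℓ 0ℓ) : Set₁ where
  field
    uncountable : ω ≺ δ
    strongLimit : ∀ X → X ≺ δ → (X ⇨ setoid Bool) ≺ δ
    regular     : ∀ X → X ≺ δ → (f : Func δ X) → ∃ λ x → ¬ (fibre f x ≺ δ)

record Signature : Set₁ where
  field
    Fun : ℕ → Set
    Rl  : ℕ → Set

record Structure (σ : Signature) : Set₁ where
  open Signature σ
  field
    domain : Setoid 0ℓ 0ℓ
  open Setoid domain public
  open VecEq domain public using (_≋_; ≋-refl; ≋-sym; ≋-trans; ≋-setoid)
  field
    fun      : ∀ {n} → Fun n → Vector Carrier n → Carrier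
    fun-cong : ∀ {n} (F : Fun n) {x y} → x ≋ y → fun F x ≈ fun F y
    rel      : ∀ {n} → Rl n → Vector Carrier n → Set
    rel-resp : ∀ {n} (R : Rl n) {x y} → x ≋ y → rel R x → rel R y

∣_∣ : ∀ {σ} → Structure σ → Set
∣ N ∣ = Structure.Carrier N

dom : ∀ {σ} → Structure σ → Setoid 0ℓ 0ℓ
dom N = Structure.domain N

record Embedding {σ} (M N : Structure σ) : Set where
  private
    module M = Structure M
    module N = Structure N
  open Signature σ
  field
    to        : ∣ M ∣ → ∣ N ∣
    cong      : Congruent M._≈_ N._≈_ to
    injective : Injective M._≈_ N._≈_ to
    fun-hom   : ∀ {n} (F : Fun n) x → to (M.fun F x) N.≈ N.fun F (to ∘ x)
    rel-hom   : ∀ {n} (R : Rl n) x → M.rel R x ⇔ N.rel R (to ∘ x)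

open Embedding public using (to)

image : ∀ {σ} {M N : Structure σ} → Embedding M N → Pred ∣ N ∣ 0ℓ
image {N = N} f y = ∃ λ x → Structure._≈_ N (to f x) y

IsIso : ∀ {σ} {M N : Structure σ} → Embedding M N → Set
IsIso f = ∀ y → y ∈ image f

Aut : ∀ {σ} → Structure σ → Set
Aut N = Σ (Embedding N N) IsIso

-- A ≼-increasing chain of structures indexed by a nonempty well-order.
record Chain {σ} (𝒦 : Structure σ → Set₁)
             (Strong : {A B : Structure σ} → Embedding A B → Set₁) : Set₁ where
  infix 4 _<_
  field
    I        : Set
    _<_      : Rel I 0ℓ
    isSTO    : IsStrictTotalOrder _≡_ _<_
    wf       : WellFounded _<_
    nonempty : I
    obj      : I → Structure σ
    inClass  : ∀ i → 𝒦 (obj i)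
    map      : ∀ {i j} → i < j → Embedding (obj i) (obj j)
    strong   : ∀ {i j} (p : i < j) → Strong (map p)
    map-∘    : ∀ {i j k} (p : i < j) (q : j < k) (r : i < k) x →
               Structure._≈_ (obj k) (to (map q) (to (map p) x)) (to (map r) x)

  record Cocone (B : Structure σ) : Set where
    field
      leg     : ∀ i → Embedding (obj i) B
      commute : ∀ {i j} (p : i < j) x →
                Structure._≈_ B (to (leg j) (to (map p) x)) (to (leg i) x)

  open Cocone public

  IsUnion : ∀ {U} → Cocone U → Set
  IsUnion {U} u = ∀ y → ∃ λ i → y ∈ image (leg u i)

-- Inclusions of substructures are represented by embeddings:  Strong f , for
-- f : A → B, says that B and the substructure f(A) of B lie in 𝒦 and that
-- f(A) ≼ B.  The Löwenheim–Skolem number being ω includes, as usual, that the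
-- signature is countable.
record AEC (σ : Signature) : Set₂ where
  field
    𝒦      : Structure σ → Set₁
    Strong : {A B : Structure σ} → Embedding A B → Set₁

    strong⇒𝒦 : ∀ {A B} (f : Embedding A B) → Strong f → 𝒦 A × 𝒦 B

    𝒦-iso      : ∀ {A B} (f : Embedding A B) → IsIso f → 𝒦 A → 𝒦 B
    strong-iso : ∀ {A B A′ B′} (f : Embedding A B) (f′ : Embedding A′ B′)
                 (g : Embedding A A′) (h : Embedding B B′) →
                 IsIso g → IsIso h →
                 (∀ x → Structure._≈_ B′ (to f′ (to g x)) (to h (to f x))) →
                 Strong f → Strong f′

    strong-refl  : ∀ {A} (f : Embedding A A) →
                   (∀ x → Structure._≈_ A (to f x) x) → 𝒦 A → Strong f
    strong-trans : ∀ {A B C} (f : Embedding A B) (g : Embedding B C)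
                   (h : Embedding A C) →
                   (∀ x → Structure._≈_ C (to g (to f x)) (to h x)) →
                   Strong f → Strong g → Strong h

    coherence : ∀ {A B C} (f : Embedding A B) (g : Embedding B C)
                (h : Embedding A C) →
                (∀ x → Structure._≈_ C (to g (to f x)) (to h x)) →
                Strong h → Strong g → Strong f

  open Chain
  field
    union-𝒦      : ∀ (c : Chain 𝒦 Strong) {U} (u : Cocone c U) → IsUnion c u → 𝒦 U
    union-strong : ∀ (c : Chain 𝒦 Strong) {U} (u : Cocone c U) → IsUnion c u →
                   ∀ i → Strong (leg u i)
    union-least  : ∀ (c : Chain 𝒦 Strong) {U} (u : Cocone c U) → IsUnion c u →
                   ∀ {B} (v : Cocone c B) → (∀ i → Strong (leg v i)) →
                   (h : Embedding U B) →
                   (∀ i x → Structure._≈_ B (to h (to (leg u i) x))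
                                            (to (leg v i) x)) →
                   Strong h

    countableSignature : (∃ (Signature.Fun σ) ⊎ ∃ (Signature.Rl σ)) ↣ ℕ
    LS : ∀ {A} → 𝒦 A → (X : Pred ∣ A ∣ 0ℓ) →
         ∃ λ C → Σ (Embedding C A) λ f →
           Strong f × X ⊆ image f × dom C ≲ (sub (dom A) X ⊎ₛ ω)

module _ {σ} (𝕂 : AEC σ) where
  open AEC 𝕂

  Amalgamation : Set₁
  Amalgamation = ∀ {A B C} (f : Embedding A B) (g : Embedding A C) →
    Strong f → Strong g →
    ∃ λ D → Σ (Embedding B D) λ h → Σ (Embedding C D) λ k →
      Strong h × Strong k ×
      (∀ x → Structure._≈_ D (to h (to f x)) (to k (to g x)))

  JointEmbedding : Set₁
  JointEmbedding = ∀ {B C} → 𝒦 B → 𝒦 C →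
    ∃ λ D → Σ (Embedding B D) λ h → Σ (Embedding C D) λ k → Strong h × Strong k

  -- Universal and model homogeneous with respect to models of size < κ.
  record IsMonster (κ : Setoid 0ℓ 0ℓ) (M : Structure σ) : Set₁ where
    field
      inClass     : 𝒦 M
      universal   : ∀ N → 𝒦 N → dom N ≺ κ → Σ (Embedding N M) Strong
      homogeneous : ∀ N → dom N ≺ κ → (f g : Embedding N M) →
                    Strong f → Strong g →
                    Σ (Aut M) λ h → ∀ x →
                      Structure._≈_ M (to (proj₁ h) (to f x)) (to g x)

-- Finite sets are given by lists.  Tuples are indexed by an arbitrary set, so
-- that enumerations of models are included; finite tuples are indexed by Fin n.

module Types {σ} (N : Structure σ) where
  open Structure N

  ⟦_⟧ : List Carrier → Pred Carrier 0ℓ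
  ⟦ xs ⟧ x = x Mem.∈ xs
    where module Mem = Membership domain

  range : ∀ {X : Set} → (X → Carrier) → Pred Carrier 0ℓ
  range a x = ∃ λ i → a i ≈ x

  infix 4 _⊂∈_
  _⊂∈_ : ∀ {X : Set} → (X → Carrier) → Pred Carrier 0ℓ → Set
  a ⊂∈ B = ∀ i → a i ∈ B

  Fixes : Pred Carrier 0ℓ → Aut N → Set
  Fixes A f = ∀ x → x ∈ A → to (proj₁ f) x ≈ x

  SameGalois : Pred Carrier 0ℓ → ∀ {X : Set} (a b : X → Carrier) → Set
  SameGalois A a b = Σ (Aut N) λ f → Fixes A f × (∀ i → to (proj₁ f) (a i) ≈ b i)

  SameType : Pred Carrier 0ℓ → ∀ {X : Set} (a b : X → Carrier) → Set
  SameType A a b = ∀ B → All A B → SameGalois ⟦ B ⟧ a b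

  SplitsOver : ∀ {m} → Vector Carrier m → Pred Carrier 0ℓ → List Carrier → Set
  SplitsOver a B A = ∃ λ n → Σ (Vector Carrier n) λ b → Σ (Vector Carrier n) λ c →
    b ⊂∈ B × c ⊂∈ B × SameType ⟦ A ⟧ b c × ¬ SameType ⟦ A ⟧ (a ++ b) (a ++ c)

  _↓ns[_]_ : ∀ {m} → Vector Carrier m → Pred Carrier 0ℓ → Pred Carrier 0ℓ → Set
  a ↓ns[ B ] C = ∃ λ A → All B A × ¬ SplitsOver a (B ∪ C) A

  _⇓ns[_]_ : Pred Carrier 0ℓ → Pred Carrier 0ℓ → Pred Carrier 0ℓ → Set
  A ⇓ns[ B ] C = ∀ {m} (a : Vector Carrier m) → a ⊂∈ A → a ↓ns[ B ] C

  realizations : ∀ {m} → Vector Carrier m → Pred Carrier 0ℓ → Setoid 0ℓ 0ℓ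
  realizations {m} a A = sub (≋-setoid m) (SameType A a)

  _∈bcl[_]_ : ∀ {m} → Vector Carrier m → Setoid 0ℓ 0ℓ → Pred Carrier 0ℓ → Set
  a ∈bcl[ δ ] A = realizations a A ≺ δ

-- Bounded means of size < δ.  The parameter sets D over which independence is
-- tested are subsets of N of size < θ.  For the monster model one takes θ = δ;
-- in the supermonster M′, where D may contain the monster, θ = |M′|.

module Lascar {σ} (N : Structure σ) (δ θ : Setoid 0ℓ 0ℓ) where
  open Structure N using (Carrier; domain; _≋_)
  open Types N

  record InvariantEquivalence (A : Pred Carrier 0ℓ) (n : ℕ) : Set₁ where
    field
      E             : Rel (Vector Carrier n) 0ℓ
      isEquivalence : IsEquivalence E
      resp          : _≋_ ⇒ E
      invariant     : ∀ f → Fixes A f → ∀ {a b} → E a b →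
                      E (to (proj₁ f) ∘ a) (to (proj₁ f) ∘ b)

    classes : Setoid 0ℓ 0ℓ
    classes = record { isEquivalence = isEquivalence }

    field
      bounded : classes ≺ δ

  SameLascar : Pred Carrier 0ℓ → ∀ {n} (a b : Vector Carrier n) → Set₁
  SameLascar B {n} a b = ∀ A → All B A → (E : InvariantEquivalence ⟦ A ⟧ n) →
    InvariantEquivalence.E E a b

  LascarSplitsOver : ∀ {m} → Vector Carrier m → Pred Carrier 0ℓ → List Carrier → Set₁
  LascarSplitsOver a B A =
    ∃ λ n → Σ (Vector Carrier n) λ b → Σ (Vector Carrier n) λ c →
      b ⊂∈ B × c ⊂∈ B × SameLascar ⟦ A ⟧ b c ×
      ¬ SameType ⟦ A ⟧ (a ++ b) (a ++ c)

  _↓[_]_ : ∀ {m} → Vector Carrier m → Pred Carrier 0ℓ → Pred Carrier 0ℓ → Set₁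
  _↓[_]_ {m} a B C = ∃ λ A → All B A ×
    (∀ D → sub domain D ≺ θ → B ∪ C ⊆ D →
      Σ (Vector Carrier m) λ b →
        SameType (B ∪ C) b a × ¬ LascarSplitsOver b D A)

module FUR {σ} (𝕂 : AEC σ) (δ : Setoid 0ℓ 0ℓ) (𝕄 : Structure σ) where
  open AEC 𝕂
  open Structure 𝕄
  open Types 𝕄

  record Model : Set₁ where
    field
      struct  : Structure σ
      incl    : Embedding struct 𝕄
      strong  : Strong incl
      bounded : dom struct ≺ δ

    set : Pred Carrier 0ℓ
    set = image incl

  open Model

  Countable : Model → Set
  Countable 𝒜 = dom (struct 𝒜) ≲ ω

  IsModel : Pred Carrier 0ℓ → Set₁
  IsModel S = Σ Model λ 𝒟 → set 𝒟 ≐ S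

  module _ {I : Set} (𝒜 : I → Model) where

    A⋃ : Pred Carrier 0ℓ
    A⋃ = ⋃ I (set ∘ 𝒜)

    imageOf : (∃ A⋃ → Carrier) → I → Pred Carrier 0ℓ
    imageOf f i y = ∃ λ (x : ∃ A⋃) → proj₁ x ∈ set (𝒜 i) × f x ≈ y

    record WeaklyElementary (f : ∃ A⋃ → Carrier) : Set₁ where
      field
        types  : ∀ {n} (a : Vector (∃ A⋃) n) → SameType ∅ (proj₁ ∘ a) (f ∘ a)
        models : ∀ i → IsModel (imageOf f i)

    record SPrime (𝒟 : Model) : Set₁ where
      field
        contains : A⋃ ⊆ set 𝒟
        prime    : ∀ ℬ (f : ∃ A⋃ → Carrier) → WeaklyElementary f →
                   (∀ x → f x ∈ set ℬ) →
                   Σ (Embedding (struct 𝒟) (struct ℬ)) λ g → Strong g ×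
                     (∀ (x : ∃ A⋃) y → to (incl 𝒟) y ≈ proj₁ x →
                        to (incl ℬ) (to g y) ≈ f x)

  record SPrimary {n} (𝒜 : Model) (a : Vector Carrier n) (ℬ : Model) : Set where
    field
      e        : ℕ → Carrier
      generate : set ℬ ≐ (set 𝒜 ∪ (range a ∪ range e))
      isolate  : ∀ k → ∃ λ Aₖ → All (set 𝒜) Aₖ ×
                 (∀ (a′ : Vector Carrier n) (e′ : Vector Carrier (suc k)) →
                   SameType (set 𝒜) a′ a →
                   SameType ⟦ Aₖ ⟧ (a′ ++ e′) (a ++ (λ i → e (toℕ i))) →
                   SameType (set 𝒜) (a′ ++ e′) (a ++ (λ i → e (toℕ i))))

  -- The legal moves (aₙ₊₁ , A′ₙ₊₁) of player I in the position (aₙ , Aₙ).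
  Move : ∀ {m} → Pred Carrier 0ℓ → Vector Carrier m → List Carrier →
         Vector Carrier m → List Carrier → Set
  Move 𝒜 a A a′ A′ = All 𝒜 A′ × ⟦ A ⟧ ⊆ ⟦ A′ ⟧ ×
    SameType ⟦ A ⟧ a′ a × ¬ SameType ⟦ A′ ⟧ a′ a

  -- Player II has a winning strategy in (at most) n moves from (a , A).
  IIWins : ∀ {m} → Pred Carrier 0ℓ → ℕ → Vector Carrier m → List Carrier → Set
  IIWins 𝒜 zero    a A = ∀ a′ A′ → ¬ Move 𝒜 a A a′ A′
  IIWins 𝒜 (suc n) a A = ∀ a′ A′ → Move 𝒜 a A a′ A′ →
    ∃ λ A″ → All 𝒜 A″ × ⟦ A′ ⟧ ⊆ ⟦ A″ ⟧ × IIWins 𝒜 n a′ A″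

  record IsFUR : Set₁ where
    field
      ap             : Amalgamation 𝕂
      jep            : JointEmbedding 𝕂
      arbitraryLarge : ∀ X → ∃ λ N → 𝒦 N × X ≲ dom N
      noFiniteModels : ∀ N → 𝒦 N → ∀ n → ¬ (dom N ≲ setoid (Fin n))

      AI : ∀ 𝒜 → Countable 𝒜 → ∀ {m} (b : Vector Carrier m) A → All (set 𝒜) A →
           ∃ λ (a : Vector Carrier m) → a ⊂∈ set 𝒜 × SameType ⟦ A ⟧ a b

      AII : ∀ {n} (a : Vector Carrier n) 𝒜 → Countable 𝒜 → ∃ λ ℬ → SPrimary 𝒜 a ℬ

      AIII : ∀ 𝒜 ℬ 𝒞 → set 𝒜 ⇓ns[ set ℬ ] set 𝒞 → set ℬ ≐ (set 𝒜 ∩ set 𝒞) →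
             let pair = λ (i : Bool) → if i then 𝒜 else 𝒞 in
             ∃ λ 𝒟 → SPrime pair 𝒟 ×
               (∀ 𝒟′ → SPrime pair 𝒟′ → set 𝒟′ ≐ set 𝒟) ×
               (∀ 𝒞′ → set 𝒞 ⊆ set 𝒞′ → set 𝒜 ⇓ns[ set ℬ ] set 𝒞′ →
                  set 𝒟 ⇓ns[ set 𝒞 ] set 𝒞′)

      AIV : ∀ {m} (a : Vector Carrier m) → ∃ λ n → ∀ 𝒜 → Countable 𝒜 →
            ∀ A → All (set 𝒜) A → IIWins (set 𝒜) n a A

      AV : ∀ 𝒜 ℬ → Countable 𝒜 → Countable ℬ → set 𝒜 ⊆ set ℬ →
           ∀ {m} (a : Vector Carrier m) →
           set ℬ ⇓ns[ set 𝒜 ] range a → a ↓ns[ set 𝒜 ] set ℬ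

      -- t(𝒞/𝒜) = t(ℬ/𝒜): the given enumeration of ℬ, and some enumeration of
      -- 𝒞 with the same index set, have the same type.
      AVI : ∀ 𝒜 ℬ 𝒟 → set 𝒜 ⊆ (set ℬ ∩ set 𝒟) →
            ∃ λ 𝒞 → (Σ (∣ struct ℬ ∣ → Carrier) λ c →
                        (range c ≐ set 𝒞) × SameType (set 𝒜) c (to (incl ℬ))) ×
                    set 𝒞 ⇓ns[ set 𝒜 ] set 𝒟

-- The countably many relations of ℰ other than equality on 𝕄, which is added
-- below as the sort  nothing.  Galois types over ∅ are given by realizations.
record ImaginarySorts {σ} (𝕄 : Structure σ) : Set₁ where
  open Structure 𝕄
  open Types 𝕄
  field
    Idx       : Set
    countable : Idx ↣ ℕ
    ar        : Idx → ℕ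
    G         : Idx → Set
    countableG : ∀ i → G i ↣ ℕ
    type      : ∀ i → G i → Vector Carrier (ar i + ar i)

  Rᴵ : ∀ i → Rel (Vector Carrier (ar i)) 0ℓ
  Rᴵ i a b = ∃ λ j → SameGalois ∅ (a ++ b) (type i j)

  field
    isEquivalenceᴵ : ∀ i → IsEquivalence (Rᴵ i)

module Eq {σ} (𝕄 : Structure σ) (ℰ : ImaginarySorts 𝕄) where
  open Structure 𝕄
  open ImaginarySorts ℰ
  open Signature σ

  arity : Maybe Idx → ℕ
  arity nothing  = 1
  arity (just i) = ar i

  R : ∀ s → Rel (Vector Carrier (arity s)) 0ℓ
  R nothing  = _≋_
  R (just i) = Rᴵ i

  R-isEquivalence : ∀ s → IsEquivalence (R s)
  R-isEquivalence nothing  = VecEq.≋-isEquivalence domain 1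
  R-isEquivalence (just i) = isEquivalenceᴵ i

  data _∈ℰ : ∀ {n} → Rel (Vector Carrier n) 0ℓ → Set₁ where
    member : ∀ s {S : Rel (Vector Carrier (arity s)) 0ℓ} →
             (∀ a b → R s a b ⇔ S a b) → S ∈ℰ

  Carrierᵉ : Set
  Carrierᵉ = Σ (Maybe Idx) (λ s → Vector Carrier (arity s))

  data _∼_ : Rel Carrierᵉ 0ℓ where
    class : ∀ {s} {a b : Vector Carrier (arity s)} → R s a b → (s , a) ∼ (s , b)

  ∼-trans : ∀ {x y z} → x ∼ y → y ∼ z → x ∼ z
  ∼-trans (class {s} p) (class q) = class (IsEquivalence.trans (R-isEquivalence s) p q)

  domainᵉ : Setoid 0ℓ 0ℓ
  domainᵉ = record
    { Carrier       = Carrierᵉ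
    ; _≈_           = _∼_
    ; isEquivalence = record
      { refl  = λ { {s , _} → class (IsEquivalence.refl (R-isEquivalence s)) }
      ; sym   = λ { (class {s} p) → class (IsEquivalence.sym (R-isEquivalence s) p) }
      ; trans = ∼-trans
      }
    }

  module Vecᵉ = VecEq domainᵉ

  home : Carrier → Carrierᵉ
  home x = nothing , (x ∷ [])

  -- The functions of 𝕄 and the maps F_E, being defined only on the home sort,
  -- are represented by their graphs.
  data Rlᵉ : ℕ → Set where
    relᵉ : ∀ {n} → Rl n → Rlᵉ n
    funᵉ : ∀ {n} → Fun n → Rlᵉ (suc n)
    P    : Maybe Idx → Rlᵉ 1
    F    : (s : Maybe Idx) → Rlᵉ (suc (arity s))

  data Funᵉ : ℕ → Set where

  σᵉ : Signature
  σᵉ = record { Fun = Funᵉ ; Rl = Rlᵉ }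

  ⟦_⟧ᵉ : ∀ {n} → Rlᵉ n → Vector Carrierᵉ n → Set
  ⟦ relᵉ S     ⟧ᵉ v = ∃ λ x → (home ∘ x) Vecᵉ.≋ v × rel S x
  ⟦ funᵉ f     ⟧ᵉ v = ∃ λ x → (home (fun f x) ∷ (home ∘ x)) Vecᵉ.≋ v
  ⟦ P s        ⟧ᵉ v = ∃ λ (x : Vector Carrier (arity s)) → ((s , x) ∷ []) Vecᵉ.≋ v
  ⟦ F s        ⟧ᵉ v = ∃ λ (x : Vector Carrier (arity s)) →
                        ((s , x) ∷ (home ∘ x)) Vecᵉ.≋ v

  ⟦⟧ᵉ-resp : ∀ {n} (S : Rlᵉ n) {v w} → v Vecᵉ.≋ w → ⟦ S ⟧ᵉ v → ⟦ S ⟧ᵉ w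
  ⟦⟧ᵉ-resp (relᵉ _) e (x , p , q) = x , Vecᵉ.≋-trans p e , q
  ⟦⟧ᵉ-resp (funᵉ _) e (x , p)     = x , Vecᵉ.≋-trans p e
  ⟦⟧ᵉ-resp (P _)    e (x , p)     = x , Vecᵉ.≋-trans p e
  ⟦⟧ᵉ-resp (F _)    e (x , p)     = x , Vecᵉ.≋-trans p e

  𝕄ᵉ : Structure σᵉ
  𝕄ᵉ = record
    { domain   = domainᵉ
    ; fun      = λ ()
    ; fun-cong = λ ()
    ; rel      = ⟦_⟧ᵉ
    ; rel-resp = ⟦⟧ᵉ-resp
    }

record Supermonster {σ} (𝕂 : AEC σ) (𝕄 : Structure σ) : Set₁ where
  field
    𝕄′        : Structure σ
    ι         : Embedding 𝕄 𝕄′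
    strong    : AEC.Strong 𝕂 ι
    larger    : dom 𝕄 ≺ dom 𝕄′
    isMonster : IsMonster 𝕂 (dom 𝕄′) 𝕄′

module Global {σ} (𝕂 : AEC σ) (δ : Setoid 0ℓ 0ℓ) (𝕄 : Structure σ)
              (𝕊 : Supermonster 𝕂 𝕄) where
  open Supermonster 𝕊
  open Structure 𝕄
  private
    module T  = Types 𝕄
    module T′ = Types 𝕄′
    module L′ = Lascar 𝕄′ δ (dom 𝕄′)

  -- p_A is the Galois type over A of the tuple  rep A.
  record GlobalType (n : ℕ) : Set where
    field
      rep : List Carrier → Vector Carrier n

    Realizes : List Carrier → Vector Carrier n → Set
    Realizes A b = T.SameGalois T.⟦ A ⟧ (rep A) b

    Realizes′ : List Carrier → Vector ∣ 𝕄′ ∣ n → Set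
    Realizes′ A b = T′.SameGalois T′.⟦ List.map (to ι) A ⟧ (to ι ∘ rep A) b

    RealizedBy : Vector ∣ 𝕄′ ∣ n → Set
    RealizedBy b = ∀ A → Realizes′ A b

    field
      coherent : ∀ A B → T.⟦ A ⟧ ⊆ T.⟦ B ⟧ → ∀ b → Realizes B b → Realizes A b
      realized : ∃ RealizedBy

  -- ℰ contains, for all b ∈ 𝕄′ and a ∈ 𝕄 such that t(b/𝕄) does not split over
  -- a, an equivalence relation obtained from some choice of types q_i^c, each
  -- of which is given by a realization  q c i.
  ContainsCanonicalRelations : ImaginarySorts 𝕄 → Set₁
  ContainsCanonicalRelations ℰ = ∀ {n m} (b : Vector ∣ 𝕄′ ∣ n) (a : Vector Carrier m) →
    ¬ T′.SplitsOver b (image ι) (toList (to ι ∘ a)) →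
    Σ (∀ {k} → Vector Carrier k → ℕ → Vector Carrier (m + k)) λ q →
      let Q : ∀ {k} → Vector Carrier k → Vector Carrier (m + k) → Set
          Q c = λ x → ∃ λ i → T.SameType ∅ x (q c i)
      in
      (∀ {k} (c d : Vector Carrier k) →
         T′.SameType ∅ (b ++ (to ι ∘ d)) (b ++ (to ι ∘ c)) ⇔ Q c (a ++ d)) ×
      (λ a₀ a₁ → ∀ {k} (c d : Vector Carrier k) → Q c (a₀ ++ d) ⇔ Q c (a₁ ++ d))
        ∈ℰ
    where open Eq 𝕄 ℰ

  module _ (ℰ : ImaginarySorts 𝕄) where
    open Eq 𝕄 ℰ
    private module Tᵉ = Types 𝕄ᵉ

    -- f(p) = p.  Here A = f(B), and b′ ∈ 𝕄 is f(b).
    Preserves : ∀ {n} → Aut 𝕄ᵉ → GlobalType n → Set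
    Preserves (f , _) p = ∀ A B →
      Tᵉ.⟦ List.map (to f ∘ home) B ⟧ ≐ Tᵉ.⟦ List.map home A ⟧ →
      ∀ b b′ → Realizes B b → (∀ i → to f (home (b i)) ∼ home (b′ i)) →
      Realizes A b′
      where open GlobalType p

    IsCanonicalBase : ∀ {k n} → Vector Carrierᵉ k → GlobalType n → Set
    IsCanonicalBase α p = ∀ (f : Aut 𝕄ᵉ) →
      Preserves f p ⇔ (∀ i → to (proj₁ f) (α i) ∼ α i)

    -- α = Cb(a/A): the tuple b and its global type p may be chosen freely.
    record IsCb {k n} (α : Vector Carrierᵉ k) (a : Vector Carrier n)
                (A : List Carrier) : Set₁ where
      field
        b             : Vector ∣ 𝕄′ ∣ n
        sameLascar    : L′.SameLascar T′.⟦ List.map (to ι) A ⟧ b (to ι ∘ a)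
        independent   : b L′.↓[ T′.⟦ List.map (to ι) A ⟧ ] image ι
        p             : GlobalType n
        p-typeOf-b    : GlobalType.RealizedBy p b
        canonicalBase : IsCanonicalBase α p

module Submission where

-- Let b ∈ 𝕄′ realize the global type p with canonical base α.  By independence
-- t(b/𝕄) does not Lascar split over A, so for f ∈ Aut(𝕄ᵉ/A) and a tuple c of 𝕄
-- the type t(b f⁻¹(c)/∅) depends only on the Lascar type of c over A.  There are
-- boundedly many of those: a relation in E(A) is invariant, hence determined by
-- its trace on a countable s-saturated model containing A, so there are fewer
-- than δ such relations, each with fewer than δ classes, and δ is strongly
-- inaccessible.  As each type over ∅ is realized in the same countable model, p
-- has boundedly many conjugates over A.  If f(p) = f′(p) then f′⁻¹f fixes p, hence
-- α, so f(α) = f′(α); therefore α has boundedly many conjugates over A.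

open import Defs
open import Axiom.ExcludedMiddle using (ExcludedMiddle)
open import Axiom.Extensionality.Propositional using (Extensionality)
open import Data.Bool.Base using (Bool; T; false; if_then_else_; true)
open import Data.Fin.Base using (Fin; _↑ʳ_; _↑ˡ_; join; splitAt; suc; toℕ; zero)
open import Data.Fin.Properties using (splitAt-join; toℕ-injective; toℕ<n)
open import Data.List.Base using (List; lookup; map)
open import Data.List.Relation.Unary.All using (All)
open import Data.Maybe.Base using (nothing)
open import Data.Nat.Base using (_+_; ℕ)
open import Data.Nat.Properties using (+-cancelˡ-≡; <⇒≱; m≤m+n; ≤-reflexive; ≤-trans)
open import Data.Product.Base using (_,_; _×_; proj₁; proj₂; Σ; ∃)
open import Data.Product.Relation.Binary.Pointwise.NonDependent using (_×ₛ_)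
open import Data.Sum.Base using ([_,_]′; _⊎_; inj₁; inj₂)
open import Data.Sum.Properties using ([,]-∘)
open import Data.Sum.Relation.Binary.Pointwise using (_⊎ₛ_)
open import Data.Vec.Functional using (Vector; []; _++_; _∷_; toList)
open import Data.Vec.Functional.Properties using (lookup-++ʳ; lookup-++ˡ)
open import Function.Base using (_∘_; id)
open import Function.Bundles using (Equivalence; Func; Injection; mk⇔)
open import Function.Relation.Binary.Setoid.Equality using (_⇨_)
open import Level using (0ℓ)
open import Relation.Binary.Bundles using (Setoid)
open import Relation.Binary.PropositionalEquality.Core using (_≡_; cong; refl; subst; sym; trans)
open import Relation.Binary.PropositionalEquality.Properties using (setoid)
open import Relation.Nullary.Decidable.Core using (Dec; True; fromWitness; isYes; no; toWitness; yes)
open import Relation.Nullary.Negation using (contradiction; ¬_)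
open import Relation.Unary using (Pred; _∈_; _⊆_; ∅)
import Data.Sum.Relation.Binary.Pointwise as Sum
import Function.Construct.Composition as Comp
import Data.List.Relation.Unary.All as All
import Data.List.Relation.Unary.Any as Any
import Data.List.Relation.Unary.Any.Properties as Any
import Data.List.Membership.Setoid.Properties as Mem

open Setoid using (Carrier)

-- Choice of representatives, excluded middle and resizing.

infix 4 _⊑_

-- Congruence is left out on purpose: codes that choose witnesses rarely respect setoid equality.
-- `⊑⇒≲` restores it by coding only the representative of each class.
record _⊑_ (X Y : Setoid 0ℓ 0ℓ) : Set where
  constructor reflecting
  field
    code     : Carrier X → Carrier Y
    reflects : ∀ {x x′} → Setoid._≈_ Y (code x) (code x′) → Setoid._≈_ X x x′

module Classical (em : ∀ {ℓ} → ExcludedMiddle ℓ)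
                 (ext : ∀ {ℓ₁ ℓ₂} → Extensionality ℓ₁ ℓ₂) where

  isYes-cong : ∀ {p q} {P : Set p} {Q : Set q} → (P → Q) → (Q → P) →
              isYes (em {P = P}) ≡ isYes (em {P = Q})
  isYes-cong {P = P} {Q} to from with em {P = P} | em {P = Q}
  ... | yes _ | yes _ = refl
  ... | no  _ | no  _ = refl
  ... | yes p | no ¬q = contradiction (to p) ¬q
  ... | no ¬p | yes q = contradiction (from q) ¬p

  isYes-cong⁻ : ∀ {p q} {P : Set p} {Q : Set q} →
               isYes (em {P = P}) ≡ isYes (em {P = Q}) → P → Q
  isYes-cong⁻ {Q = Q} eq p = toWitness {a? = em {P = Q}} (subst T eq (fromWitness {a? = em} p))

  module _ (X : Setoid 0ℓ 0ℓ) where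
    private module X = Setoid X

    private
      χ : X.Carrier → X.Carrier → Bool
      χ x y = isYes (em {P = y X.≈ x})

      pick : (s : X.Carrier → Bool) → ∃ (T ∘ s) → ∃ (T ∘ s)
      pick s w with em {P = ∃ (T ∘ s)}
      ... | yes w′ = w′
      ... | no ¬w  = contradiction w ¬w

      pick-irrelevant : ∀ s w w′ → pick s w ≡ pick s w′
      pick-irrelevant s w w′ with em {P = ∃ (T ∘ s)}
      ... | yes _ = refl
      ... | no ¬w = contradiction w ¬w

      inhabited : ∀ x → ∃ (T ∘ χ x)
      inhabited x = x , fromWitness {a? = em} X.refl

    -- Excluded middle for types is a global choice operator; applied to the
    -- Boolean characteristic function of a class, which by extensionality
    -- depends on the class only, it picks a representative.
    rep : X.Carrier → X.Carrier
    rep x = proj₁ (pick (χ x) (inhabited x))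

    rep-≈ : ∀ x → rep x X.≈ x
    rep-≈ x = toWitness {a? = em} (proj₂ (pick (χ x) (inhabited x)))

    rep-cong : ∀ {x y} → x X.≈ y → rep x ≡ rep y
    rep-cong {x} {y} x≈y = go (χ x) (χ y) (inhabited x) (inhabited y)
      (ext λ z → isYes-cong (λ p → X.trans p x≈y) (λ p → X.trans p (X.sym x≈y)))
      where
      -- The characteristic functions become variables here, so that their equality can be matched
      -- with `refl` although the witnesses differ.
      go : ∀ s t w w′ → s ≡ t → proj₁ (pick s w) ≡ proj₁ (pick t w′)
      go s .s w w′ refl = cong proj₁ (pick-irrelevant s w w′)

  ⊑⇒≲ : ∀ {X Y} → X ⊑ Y → X ≲ Y
  ⊑⇒≲ {X} {Y} (reflecting h r) = record
    { to        = h ∘ rep X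
    ; cong      = λ x≈y → Setoid.reflexive Y (cong h (rep-cong X x≈y))
    ; injective = λ {x} {y} e →
        Setoid.trans X (Setoid.sym X (rep-≈ X x)) (Setoid.trans X (r e) (rep-≈ X y))
    }

  pred : (X : Setoid 0ℓ 0ℓ) (P : Carrier X → Set) →
         (∀ {x y} → Setoid._≈_ X x y → P x → P y) → Func X (setoid Bool)
  pred X P resp = record
    { to   = λ x → isYes (em {P = P x})
    ; cong = λ x≈y → isYes-cong (resp x≈y) (resp (Setoid.sym X x≈y))
    }

  Resized : ∀ {ℓ} → Set ℓ → Set
  Resized P = True (em {P = P})

  resize : ∀ {ℓ} {P : Set ℓ} → P → Resized P
  resize = fromWitness

  unresize : ∀ {ℓ} {P : Set ℓ} → Resized P → P
  unresize = toWitness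

  dne : ∀ {ℓ} {P : Set ℓ} → ¬ ¬ P → P
  dne {P = P} ¬¬p with em {P = P}
  ... | yes p = p
  ... | no ¬p = contradiction ¬p ¬¬p

  -- Cardinal arithmetic below a strongly inaccessible cardinal.

  module Cardinal (δ : Setoid 0ℓ 0ℓ) (inaccessible : StronglyInaccessible δ) where
    open StronglyInaccessible inaccessible

    Small : Setoid 0ℓ 0ℓ → Set
    Small X = X ≺ δ

    small-≲ : ∀ {X Y} → X ≲ Y → Small Y → Small X
    small-≲ i (j , k) = Comp.injection i j , λ l → k (Comp.injection l i)

    small-⊑ : ∀ {X Y} → X ⊑ Y → Small Y → Small X
    small-⊑ i = small-≲ (⊑⇒≲ i)

    small-ω : Small ω
    small-ω = uncountable

    small-Bool : Small (setoid Bool)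
    small-Bool = small-⊑ (reflecting (λ b → if b then 1 else 0) λ
      { {true} {true} _ → refl ; {false} {false} _ → refl
      ; {true} {false} () ; {false} {true} () }) small-ω

    small-Fin : ∀ n → Small (setoid (Fin n))
    small-Fin n = small-⊑ (reflecting toℕ toℕ-injective) small-ω

    module _ {X : Setoid 0ℓ 0ℓ} (small-X : Small X)
             {Y : Carrier X → Setoid 0ℓ 0ℓ} (small-Y : ∀ x → Small (Y x)) where
      private
        module X = Setoid X
        module δ = Setoid δ
        module Y x = Setoid (Y x)

        j : ∀ x → Y.Carrier x → δ.Carrier
        j x = Injection.to (proj₁ (small-Y x))

      -- The members of the family are placed inside δ, so that their union is
      -- at most δ without any comparison of cardinals.
      ⋃Y : Setoid 0ℓ 0ℓ
      ⋃Y = sub δ (λ d → ∃ λ x → ∃ λ y → j (rep X x) y δ.≈ d)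

      -- Only members at representatives are used: `Y` need not respect the equality of `X`, whereas
      -- equal indices have literally the same representative.
      ⋃Y-inj : ∀ x → Y.Carrier (rep X x) → Carrier ⋃Y
      ⋃Y-inj x y = j (rep X x) y , x , y , δ.refl

      ⋃Y-reflects : ∀ x {y y′} → Setoid._≈_ ⋃Y (⋃Y-inj x y) (⋃Y-inj x y′) →
                    Y._≈_ (rep X x) y y′
      ⋃Y-reflects x = Injection.injective (proj₁ (small-Y (rep X x)))

      -- An injection of δ into the union labels each element of δ by an index. Each fibre of the
      -- labelling embeds in a single small member, which contradicts regularity.
      small-⋃ : Small ⋃Y
      small-⋃ = ⊑⇒≲ (reflecting proj₁ λ e → e) , λ g → impossible g
        where
        impossible : ¬ (δ ≲ ⋃Y)
        impossible g = proj₂ (regular X small-X f) (small-⊑ fibre⊑Y (small-Y _))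
          where
          module g = Injection g

          -- Equality in the union forgets the index; evaluating at representatives makes the
          -- labelling respect equality in δ.
          u : δ.Carrier → Carrier ⋃Y
          u d = g.to (rep δ d)

          f : Func δ X
          f = record { to   = λ d → proj₁ (proj₂ (u d))
                     ; cong = λ e → X.reflexive (cong (proj₁ ∘ proj₂ ∘ g.to) (rep-cong δ e)) }

          x₀ : X.Carrier
          x₀ = proj₁ (regular X small-X f)

          y₀ : ∀ d {r} → rep X (proj₁ (proj₂ (u d))) ≡ r →
               ∃ λ (y : Y.Carrier r) → j r y δ.≈ proj₁ (u d)
          y₀ d refl = proj₂ (proj₂ (u d))

          fibre⊑Y : fibre f x₀ ⊑ Y (rep X x₀)
          fibre⊑Y = reflecting (λ (d , e) → proj₁ (y₀ d (rep-cong X e)))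
            λ { {d , e} {d′ , e′} y≈y′ →
              δ.trans (δ.sym (rep-≈ δ d)) (δ.trans
                (g.injective (δ.trans (δ.sym (proj₂ (y₀ d (rep-cong X e))))
                  (δ.trans (Injection.cong (proj₁ (small-Y (rep X x₀))) y≈y′)
                           (proj₂ (y₀ d′ (rep-cong X e′))))))
                (rep-≈ δ d′)) }

    𝒫 : Setoid 0ℓ 0ℓ → Setoid 0ℓ 0ℓ
    𝒫 X = X ⇨ setoid Bool

    small-𝒫 : ∀ {X} → Small X → Small (𝒫 X)
    small-𝒫 {X} = strongLimit X

    -- The pair (x , y) is coded by { S ∣ x ∈ S and (x = y or y ∉ S) }.
    square⊑𝒫𝒫 : ∀ W → (W ×ₛ W) ⊑ 𝒫 (𝒫 W)
    square⊑𝒫𝒫 W = reflecting pair reflects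
      where
      open Setoid W renaming (Carrier to C; refl to ≈-refl; sym to ≈-sym; trans to ≈-trans)

      _∋_ : Func W (setoid Bool) → C → Set
      S ∋ x = T (Func.to S x)

      In : C × C → Func W (setoid Bool) → Set
      In (x , y) S = S ∋ x × (x ≈ y ⊎ ¬ (S ∋ y))

      pair : C × C → Func (𝒫 W) (setoid Bool)
      pair p = pred (𝒫 W) (In p) λ e → λ where
        (s , inj₁ q) → subst T (e _) s , inj₁ q
        (s , inj₂ q) → subst T (e _) s , inj₂ (q ∘ subst T (sym (e _)))

      -- Three test sets recover the pair: the singleton of `x` gives the first coordinate, the full
      -- set tells whether the coordinates agree, and the complement of `y` gives the second
      -- coordinate when they differ.
      singleton complement : C → Func W (setoid Bool)
      singleton x  = pred W (x ≈_) λ y≈z x≈y → ≈-trans x≈y y≈z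
      complement x = pred W (λ y → ¬ (x ≈ y)) λ y≈z x≉y x≈z → x≉y (≈-trans x≈z (≈-sym y≈z))

      full : Func W (setoid Bool)
      full = pred W (λ y → y ≈ y) λ _ _ → ≈-refl

      reflects : ∀ {p q} → Setoid._≈_ (𝒫 (𝒫 W)) (pair p) (pair q) → Setoid._≈_ (W ×ₛ W) p q
      reflects {x , y} {x′ , y′} e = x≈x′ , second em
        where
        ⇒ : ∀ S → In (x , y) S → In (x′ , y′) S
        ⇒ S = isYes-cong⁻ (e S)

        ⇐ : ∀ S → In (x′ , y′) S → In (x , y) S
        ⇐ S = isYes-cong⁻ (sym (e S))

        in-singleton : Dec (x ≈ y) → In (x , y) (singleton x)
        in-singleton (yes x≈y) = fromWitness {a? = em} ≈-refl , inj₁ x≈y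
        in-singleton (no  x≉y) = fromWitness {a? = em} ≈-refl , inj₂ (x≉y ∘ toWitness {a? = em})

        x≈x′ : x ≈ x′
        x≈x′ = toWitness {a? = em} (proj₁ (⇒ (singleton x) (in-singleton em)))

        ∈full : ∀ z → full ∋ z
        ∈full z = fromWitness {a? = em} ≈-refl

        diagonal : ∀ {u v} → In (u , v) full → u ≈ v
        diagonal (_ , inj₁ u≈v) = u≈v
        diagonal {v = v} (_ , inj₂ v∉) = contradiction (∈full v) v∉

        off-diagonal : ¬ (x ≈ y) → In (x′ , y′) (complement y) → y ≈ y′
        off-diagonal x≉y (_ , inj₁ x′≈y′) =
          contradiction (diagonal (⇐ full (∈full x′ , inj₁ x′≈y′))) x≉y
        off-diagonal x≉y (_ , inj₂ y′∉)   = dne λ y≉y′ → y′∉ (fromWitness {a? = em} y≉y′)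

        second : Dec (x ≈ y) → y ≈ y′
        second (yes x≈y) = ≈-trans (≈-sym x≈y) (≈-trans x≈x′
                             (diagonal (⇒ full (∈full x , inj₁ x≈y))))
        second (no  x≉y) = off-diagonal x≉y (⇒ (complement y)
                             ( fromWitness {a? = em} (x≉y ∘ ≈-sym)
                             , inj₂ λ y∈ → toWitness {a? = em} y∈ ≈-refl))

    -- Both factors embed in the union `W` of the two-member family, so their product embeds in the
    -- square of `W`, hence in a double power set, which is small by the strong limit property.
    small-× : ∀ {X Y} → Small X → Small Y → Small (X ×ₛ Y)
    small-× {X} {Y} sx sy = small-⊑ (reflecting
        (λ (x , y) → ι₁ x , ι₂ y)
        λ (e , e′) → ι₁-reflects e , ι₂-reflects e′)
        (small-⊑ (square⊑𝒫𝒫 W) (small-𝒫 (small-𝒫 small-W)))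
      where
      Z : Bool → Setoid 0ℓ 0ℓ
      Z b = if b then X else Y

      sz : ∀ b → Small (Z b)
      sz true  = sx
      sz false = sy

      W : Setoid 0ℓ 0ℓ
      W = ⋃Y small-Bool sz

      small-W : Small W
      small-W = small-⋃ small-Bool sz

      -- The representative of a Boolean equals it only propositionally, so elements are transported
      -- to the member that `⋃Y-inj` expects.
      ι : ∀ b {c} → c ≡ b → Carrier (Z b) → Carrier (Z c)
      ι b refl z = z

      ι-reflects : ∀ b {c} (e : c ≡ b) {z z′} →
                   Setoid._≈_ (Z c) (ι b e z) (ι b e z′) → Setoid._≈_ (Z b) z z′
      ι-reflects b refl p = p

      ι₁ : Carrier X → Carrier W
      ι₁ x = ⋃Y-inj small-Bool sz true (ι true (rep-≈ (setoid Bool) true) x)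

      ι₂ : Carrier Y → Carrier W
      ι₂ y = ⋃Y-inj small-Bool sz false (ι false (rep-≈ (setoid Bool) false) y)

      ι₁-reflects : ∀ {x x′} → Setoid._≈_ W (ι₁ x) (ι₁ x′) → Setoid._≈_ X x x′
      ι₁-reflects e = ι-reflects true (rep-≈ (setoid Bool) true)
        (⋃Y-reflects small-Bool sz true e)

      ι₂-reflects : ∀ {y y′} → Setoid._≈_ W (ι₂ y) (ι₂ y′) → Setoid._≈_ Y y y′
      ι₂-reflects e = ι-reflects false (rep-≈ (setoid Bool) false)
        (⋃Y-reflects small-Bool sz false e)

    -- An element of `Z` is coded by the graph of its coordinates, a subset of the product of `X`
    -- and the union of the `Y x`. Since `Z` is only required to be separated by its coordinates,
    -- the maps `φ x` need not respect equality.
    small-Π : ∀ {X} (sx : Small X) {Y : Carrier X → Setoid 0ℓ 0ℓ} (sy : ∀ x → Small (Y x))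
              {Z : Setoid 0ℓ 0ℓ} (φ : ∀ x → Carrier Z → Carrier (Y x)) →
              (∀ {z z′} → (∀ x → Setoid._≈_ (Y (rep X x)) (φ (rep X x) z) (φ (rep X x) z′)) →
                Setoid._≈_ Z z z′) →
              Small Z
    small-Π {X} sx {Y} sy {Z} φ separates =
      small-⊑ (reflecting graph reflects) (small-𝒫 (small-× sx (small-⋃ sx sy)))
      where
      U = ⋃Y sx sy
      module U = Setoid U

      value : Carrier Z → Carrier X → U.Carrier
      value z x = ⋃Y-inj sx sy x (φ (rep X x) z)

      value-cong : ∀ z {x x′} → Setoid._≈_ X x x′ → value z x U.≈ value z x′
      value-cong z e = Setoid.reflexive δ
        (cong (λ r → Injection.to (proj₁ (sy r)) (φ r z)) (rep-cong X e))

      graph : Carrier Z → Func (X ×ₛ U) (setoid Bool)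
      graph z = pred (X ×ₛ U) (λ (x , u) → value z x U.≈ u) λ { {x , u} {x′ , u′} (e , e′) p →
        U.trans {value z x′} {value z x} {u′} (value-cong z (Setoid.sym X e))
          (U.trans {value z x} {u} {u′} p e′) }

      reflects : ∀ {z z′} → Setoid._≈_ (𝒫 (X ×ₛ U)) (graph z) (graph z′) → Setoid._≈_ Z z z′
      reflects {z} {z′} e = separates λ x → Setoid.sym (Y (rep X x))
        (⋃Y-reflects sx sy x (isYes-cong⁻ (e (x , value z x)) (U.refl {value z x})))

    small-⊎ω : ∀ {X} → Small X → Small (X ⊎ₛ ω)
    small-⊎ω {X} sx with em {P = Carrier X}
    -- The tag says which coordinate carries information; `x₀` and `0` fill the other one.
    ... | yes x₀ = small-⊑ (reflecting c r) (small-× small-Bool (small-× sx small-ω))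
      where
      c : Carrier X ⊎ ℕ → Bool × Carrier X × ℕ
      c (inj₁ x) = true , x , 0
      c (inj₂ n) = false , x₀ , n

      r : ∀ {s s′} → Setoid._≈_ (setoid Bool ×ₛ (X ×ₛ ω)) (c s) (c s′) →
          Setoid._≈_ (X ⊎ₛ ω) s s′
      r {inj₁ _} {inj₁ _} (_ , e , _)  = Sum.inj₁ e
      r {inj₂ _} {inj₂ _} (_ , _ , e)  = Sum.inj₂ e
      r {inj₁ _} {inj₂ _} (() , _)
      r {inj₂ _} {inj₁ _} (() , _)
    ... | no ¬x = small-⊑ (reflecting c r) small-ω
      where
      c : Carrier X ⊎ ℕ → ℕ
      c (inj₁ x) = contradiction x ¬x
      c (inj₂ n) = n

      r : ∀ {s s′} → c s ≡ c s′ → Setoid._≈_ (X ⊎ₛ ω) s s′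
      r {inj₁ x} _ = contradiction x ¬x
      r {inj₂ _} {inj₁ x} _ = contradiction x ¬x
      r {inj₂ _} {inj₂ _} e = Sum.inj₂ e

-- Embeddings and the group of automorphisms.

module _ {σ : Signature} where
  open Embedding using (injective; fun-hom; rel-hom) renaming (cong to to-cong)

  idₑ : {A : Structure σ} → Embedding A A
  idₑ {A} = record
    { to = id ; cong = id ; injective = id
    ; fun-hom = λ _ _ → Structure.refl A ; rel-hom = λ _ _ → mk⇔ id id }

  infixr 9 _∘ₑ_

  _∘ₑ_ : {A B C : Structure σ} → Embedding B C → Embedding A B → Embedding A C
  _∘ₑ_ {C = C} g f = record
    { to        = to g ∘ to f
    ; cong      = to-cong g ∘ to-cong f
    ; injective = injective f ∘ injective g
    ; fun-hom   = λ F x → Structure.trans C (to-cong g (fun-hom f F x)) (fun-hom g F _)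
    ; rel-hom   = λ R x → mk⇔
        (Equivalence.to (rel-hom g R _) ∘ Equivalence.to (rel-hom f R x))
        (Equivalence.from (rel-hom f R x) ∘ Equivalence.from (rel-hom g R _))
    }

  -- Preimages under `e` are unique up to equality, so choosing them gives an embedding. With `h`
  -- the identity and `e` an automorphism this is the inverse.
  factor : {A B C : Structure σ} (e : Embedding B C) (h : Embedding A C) →
           (∀ x → to h x ∈ image e) →
           Σ (Embedding A B) λ f → ∀ x → Structure._≈_ C (to e (to f x)) (to h x)
  factor {A} {B} {C} e h im = record
      { to        = f
      ; cong      = λ p → injective e (C.trans (ef _) (C.trans (to-cong h p) (C.sym (ef _))))
      ; injective = λ p → injective h (C.trans (C.sym (ef _)) (C.trans (to-cong e p) (ef _)))
      ; fun-hom   = λ F x → injective e (C.trans (ef _) (C.trans (fun-hom h F x)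
          (C.trans (C.fun-cong F λ i → C.sym (ef _)) (C.sym (fun-hom e F _)))))
      ; rel-hom   = λ R x → mk⇔
          (λ r → Equivalence.from (rel-hom e R _)
                   (C.rel-resp R (λ i → C.sym (ef _)) (Equivalence.to (rel-hom h R x) r)))
          (λ r → Equivalence.from (rel-hom h R x)
                   (C.rel-resp R (λ i → ef _) (Equivalence.to (rel-hom e R _) r)))
      } , ef
    where
    module C = Structure C

    f : ∣ A ∣ → ∣ B ∣
    f x = proj₁ (im x)

    ef : ∀ x → to e (f x) C.≈ to h x
    ef x = proj₂ (im x)

  ⟨_⟩ : {N : Structure σ} → Aut N → ∣ N ∣ → ∣ N ∣
  ⟨ f ⟩ = to (proj₁ f)

  module _ {N : Structure σ} where
    open Structure N using (_≈_) renaming (refl to ≈-refl; sym to ≈-sym; trans to ≈-trans)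

    infixr 9 _∘ₐ_
    infix 10 _⁻¹

    idₐ : Aut N
    idₐ = idₑ , λ y → y , ≈-refl

    _∘ₐ_ : Aut N → Aut N → Aut N
    (g , g-iso) ∘ₐ (f , f-iso) = g ∘ₑ f , λ z →
      let y , gy≈z = g-iso z ; x , fx≈y = f-iso y
      in x , ≈-trans (to-cong g fx≈y) gy≈z

    _⁻¹ : Aut N → Aut N
    (f , f-iso) ⁻¹ = let g , fg = factor f idₑ f-iso in
      g , λ y → to f y , injective f (fg _)

    inverseʳ : (f : Aut N) → ∀ x → ⟨ f ⟩ (⟨ f ⁻¹ ⟩ x) ≈ x
    inverseʳ (f , f-iso) = proj₂ (factor f idₑ f-iso)

    inverseˡ : (f : Aut N) → ∀ x → ⟨ f ⁻¹ ⟩ (⟨ f ⟩ x) ≈ x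
    inverseˡ f x = injective (proj₁ f) (inverseʳ f (⟨ f ⟩ x))

-- Calculus of Galois types.

module Galois {σ} (N : Structure σ) where
  open Structure N renaming (refl to ≈-refl; sym to ≈-sym; trans to ≈-trans)
  open Types N

  private
    cg : (f : Aut N) → ∀ {x y} → x ≈ y → ⟨ f ⟩ x ≈ ⟨ f ⟩ y
    cg f = Embedding.cong (proj₁ f)

    variable
      A B : Pred ∣ N ∣ 0ℓ
      X Y : Set
      a b c : X → ∣ N ∣

  fixes-⁻¹ : (f : Aut N) → Fixes A f → Fixes A (f ⁻¹)
  fixes-⁻¹ f fix x x∈ = ≈-trans (cg (f ⁻¹) (≈-sym (fix x x∈))) (inverseˡ f x)

  galois-≋ : (∀ i → a i ≈ b i) → SameGalois A a b
  galois-≋ e = idₐ , (λ _ _ → ≈-refl) , e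

  galois-sym : SameGalois A a b → SameGalois A b a
  galois-sym (f , fix , m) =
    f ⁻¹ , fixes-⁻¹ f fix , λ i → ≈-trans (cg (f ⁻¹) (≈-sym (m i))) (inverseˡ f _)

  galois-trans : SameGalois A a b → SameGalois A b c → SameGalois A a c
  galois-trans (f , fix , m) (g , fix′ , m′) =
    g ∘ₐ f , (λ x x∈ → ≈-trans (cg g (fix x x∈)) (fix′ x x∈)) ,
    λ i → ≈-trans (cg g (m i)) (m′ i)

  galois-mono : A ⊆ B → SameGalois B a b → SameGalois A a b
  galois-mono A⊆B (f , fix , m) = f , (λ x → fix x ∘ A⊆B) , m

  galois-∅ : SameGalois A a b → SameGalois ∅ a b
  galois-∅ = galois-mono λ ()

  galois-∘ : (r : Y → X) → SameGalois A a b → SameGalois A (a ∘ r) (b ∘ r)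
  galois-∘ r (f , fix , m) = f , fix , m ∘ r

  -- Parameters are traded for an appended tuple, so that types over different sets can be compared
  -- as types over ∅. Indexing by a sum keeps the two halves apart without arithmetic on `Fin`.
  fixing⇒pair : {a b : X → ∣ N ∣} {w : Y → ∣ N ∣} → w ⊂∈ A →
                SameGalois A a b → SameGalois ∅ [ a , w ]′ [ b , w ]′
  fixing⇒pair w⊂A (f , fix , m) = f , (λ _ ()) , λ where
    (inj₁ i) → m i
    (inj₂ j) → fix _ (w⊂A j)

  pair⇒fixing : {a b : X → ∣ N ∣} {w : Y → ∣ N ∣} → A ⊆ range w →
                SameGalois ∅ [ a , w ]′ [ b , w ]′ → SameGalois A a b
  pair⇒fixing A⊆w (f , _ , m) =
    f , (λ x x∈ → let j , wj≈x = A⊆w x∈ in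
           ≈-trans (cg f (≈-sym wj≈x)) (≈-trans (m (inj₂ j)) wj≈x)) ,
    m ∘ inj₁

  pair⇒++ : ∀ {k l} {a a′ : Vector ∣ N ∣ k} {b b′ : Vector ∣ N ∣ l} →
            SameGalois A [ a , b ]′ [ a′ , b′ ]′ → SameGalois A (a ++ b) (a′ ++ b′)
  pair⇒++ {k = k} = galois-∘ (splitAt k)

  ++⇒pair : ∀ {k l} {a a′ : Vector ∣ N ∣ k} {b b′ : Vector ∣ N ∣ l} →
            SameGalois A (a ++ b) (a′ ++ b′) → SameGalois A [ a , b ]′ [ a′ , b′ ]′
  ++⇒pair {k = k} {l} {a} {a′} {b} {b′} (f , fix , m) = f , fix , λ s →
    subst (λ t → ⟨ f ⟩ ([ a , b ]′ t) ≈ [ a′ , b′ ]′ t) (splitAt-join k l s) (m (join k l s))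

  all-⟦⟧ : ∀ xs → All ⟦ xs ⟧ xs
  all-⟦⟧ xs = All.tabulateₛ domain id

  type⇒galois : ∀ xs → SameType ⟦ xs ⟧ a b → SameGalois ⟦ xs ⟧ a b
  type⇒galois xs t = t xs (all-⟦⟧ xs)

  ⟦⟧⊆range : ∀ xs → ⟦ xs ⟧ ⊆ range (lookup xs)
  ⟦⟧⊆range xs x∈ = Any.index x∈ , ≈-sym (Any.lookup-index x∈)

  lookup⊂∈ : ∀ xs → lookup xs ⊂∈ ⟦ xs ⟧
  lookup⊂∈ xs = Mem.∈-lookup domain xs

-- Strong embeddings and Löwenheim-Skolem hulls.

module Hull (em : ∀ {ℓ} → ExcludedMiddle ℓ) (ext : ∀ {ℓ₁ ℓ₂} → Extensionality ℓ₁ ℓ₂)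
            (δ : Setoid 0ℓ 0ℓ) (inaccessible : StronglyInaccessible δ)
            {σ} (𝕂 : AEC σ) where
  open AEC 𝕂
  open Classical em ext
  open Cardinal δ inaccessible

  id-strong : ∀ {A} → 𝒦 A → Strong (idₑ {A = A})
  id-strong {A} = strong-refl idₑ λ _ → Structure.refl A

  iso-strong : ∀ {A B} (f : Embedding A B) → IsIso f → 𝒦 A → Strong f
  iso-strong {A} {B} f f-iso A∈𝒦 =
    strong-iso idₑ f idₑ f (λ y → y , Structure.refl A) f-iso (λ _ → Structure.refl B)
      (id-strong A∈𝒦)

  ∘-strong : ∀ {A B C} (g : Embedding B C) (f : Embedding A B) →
             Strong g → Strong f → Strong (g ∘ₑ f)
  ∘-strong {C = C} g f sg sf = strong-trans f g (g ∘ₑ f) (λ _ → Structure.refl C) sf sg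

  hull : ∀ {N} → 𝒦 N → ∀ {Y} → Small Y → (w : Carrier Y → ∣ N ∣) →
         (∀ {y y′} → Setoid._≈_ Y y y′ → Structure._≈_ N (w y) (w y′)) →
         ∃ λ C → Σ (Embedding C N) λ e → Strong e × (∀ y → w y ∈ image e) × Small (dom C)
  hull {N} N∈𝒦 {Y} small-Y w w-cong =
    let C , e , se , w⊆e , C≲ = LS N∈𝒦 (Types.range N w) in
    C , e , se , (λ y → w⊆e (y , N.refl)) , small-≲ C≲ (small-⊎ω (small-⊑ range⊑Y small-Y))
    where
    module N = Structure N

    range⊑Y : sub (dom N) (Types.range N w) ⊑ Y
    range⊑Y = reflecting (λ (_ , y , _) → y) λ { {_ , _ , p} {_ , _ , p′} e →
      N.trans (N.sym p) (N.trans (w-cong e) p′) }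

  countableHull : ∀ {N} → 𝒦 N → ∀ {l} (w : Vector ∣ N ∣ l) →
    ∃ λ C → Σ (Embedding C N) λ e → Strong e × (∀ i → w i ∈ image e) × dom C ≲ ω
  countableHull {N} N∈𝒦 {l} w =
    let C , e , se , w⊆e , C≲ = LS N∈𝒦 (Types.range N w) in
    C , e , se , (λ i → w⊆e (i , N.refl)) , ⊑⇒≲ (reflecting (code ∘ Injection.to C≲)
      (Injection.injective C≲ ∘ reflects))
    where
    module N = Structure N
    S : Setoid 0ℓ 0ℓ
    S = sub (dom N) (Types.range N w) ⊎ₛ ω

    -- The tuple takes codes below `l`, and ω is shifted past them.
    code : Carrier S → ℕ
    code (inj₁ (_ , i , _)) = toℕ i
    code (inj₂ n)           = l + n

    toℕ≢+ : ∀ {i : Fin l} {n} → ¬ (toℕ i ≡ l + n)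
    toℕ≢+ {i} {n} e = <⇒≱ (toℕ<n i) (≤-trans (m≤m+n l n) (≤-reflexive (sym e)))

    reflects : ∀ {s s′} → code s ≡ code s′ → Setoid._≈_ S s s′
    reflects {inj₁ (_ , i , p)} {inj₁ (_ , i′ , p′)} e with refl ← toℕ-injective e =
      Sum.inj₁ (N.trans (N.sym p) p′)
    reflects {inj₂ _} {inj₂ _} e = Sum.inj₂ (+-cancelˡ-≡ l _ _ e)
    reflects {inj₁ (_ , i , _)} {inj₂ n} e = contradiction e (toℕ≢+ {i})
    reflects {inj₂ n} {inj₁ (_ , i , _)} e = contradiction (sym e) (toℕ≢+ {i})

  -- Transfer of types between the monster and the supermonster.

  module Extension (𝕄 : Structure σ) (monster : IsMonster 𝕂 δ 𝕄)
                   (𝕊 : Supermonster 𝕂 𝕄) where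
    open Supermonster 𝕊
    open IsMonster monster
    private
      module M  = Structure 𝕄
      module M′ = Structure 𝕄′
      module T  = Types 𝕄
      module T′ = Types 𝕄′

    -- Relative to 𝕄′ the monster itself is a small model, so homogeneity of 𝕄′ applies to the
    -- strong embeddings `ι` and `ι ∘ₑ g`.
    lift : (g : Aut 𝕄) → Σ (Aut 𝕄′) λ F → ∀ x → ⟨ F ⟩ (to ι x) M′.≈ to ι (⟨ g ⟩ x)
    lift (g , g-iso) = IsMonster.homogeneous isMonster 𝕄 larger ι (ι ∘ₑ g) strong
      (∘-strong ι g strong (iso-strong g g-iso inClass))

    lift-galois : ∀ {A : Pred ∣ 𝕄 ∣ 0ℓ} {A′ : Pred ∣ 𝕄′ ∣ 0ℓ} →
                  (∀ {y} → y ∈ A′ → ∃ λ x → x ∈ A × y M′.≈ to ι x) →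
                  ∀ {X : Set} {a b : X → ∣ 𝕄 ∣} → T.SameGalois A a b →
                  T′.SameGalois A′ (to ι ∘ a) (to ι ∘ b)
    lift-galois cover (g , fix , m) with F , Fι ← lift g =
      F , (λ y y∈ → let x , x∈ , y≈ιx = cover y∈ in
             M′.trans (Embedding.cong (proj₁ F) y≈ιx) (M′.trans (Fι x)
               (M′.trans (Embedding.cong ι (fix x x∈)) (M′.sym y≈ιx)))) ,
      λ i → M′.trans (Fι _) (Embedding.cong ι (m i))

    lift-galois-∅ : ∀ {X : Set} {a b : X → ∣ 𝕄 ∣} → T.SameGalois ∅ a b →
                    T′.SameGalois ∅ (to ι ∘ a) (to ι ∘ b)
    lift-galois-∅ = lift-galois λ ()

    -- An automorphism of 𝕄′ need not preserve 𝕄; instead it is compared on a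
    -- bounded N₁ ≼ 𝕄 with the inclusion inside a bounded N₂ ≼ 𝕄′, and N₂ is
    -- mapped back to 𝕄 by universality.
    descend-galois : ∀ {k} {x y : Vector ∣ 𝕄 ∣ k} →
                     T′.SameGalois ∅ (to ι ∘ x) (to ι ∘ y) → T.SameGalois ∅ x y
    descend-galois {k} {x} {y} (F , _ , Fx≈y)
      with N₁ , u , su , xy∈u , small₁ ← hull inClass (small-Fin (k + k)) (x ++ y)
                                           (λ { refl → M.refl })
      with N₂ , v , sv , N₁∈v , small₂ ← hull (IsMonster.inClass isMonster)
             (small-× small-Bool small₁)
             -- `N₂` contains two copies of `N₁`: its inclusion, tagged `true`, and its image under
             -- `F`, tagged `false`.
             (λ { (true , n) → to ι (to u n) ; (false , n) → ⟨ F ⟩ (to ι (to u n)) })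
             (λ { {true , _} {true , _} (_ , e) → Embedding.cong (ι ∘ₑ u) e
                ; {false , _} {false , _} (_ , e) → Embedding.cong (proj₁ F ∘ₑ ι ∘ₑ u) e
                ; {true , _} {false , _} (() , _) ; {false , _} {true , _} (() , _) })
      with i₁ , vi₁ ← factor v (ι ∘ₑ u) (λ n → N₁∈v (true , n))
      with i₂ , vi₂ ← factor v (proj₁ F ∘ₑ ι ∘ₑ u) (λ n → N₁∈v (false , n))
      with h , sh ← universal N₂ (proj₁ (strong⇒𝒦 v sv)) small₂
      = K ⁻¹ ∘ₐ G , (λ _ ()) , λ i → M.trans
          (Embedding.cong (proj₁ (K ⁻¹)) (Gx≈Ky i)) (inverseˡ K (y i))
      where
      sιu : Strong (ι ∘ₑ u)
      sιu = ∘-strong ι u strong su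

      si₁ : Strong i₁
      si₁ = coherence i₁ v (ι ∘ₑ u) vi₁ sιu sv

      si₂ : Strong i₂
      si₂ = coherence i₂ v (proj₁ F ∘ₑ ι ∘ₑ u) vi₂
        (∘-strong (proj₁ F) (ι ∘ₑ u)
          (iso-strong (proj₁ F) (proj₂ F) (IsMonster.inClass isMonster)) sιu) sv

      -- Homogeneity of 𝕄 extends both copies, sent into 𝕄 by `h`, to automorphisms. As `F` takes
      -- `x` to `y`, `G` at `x` agrees with `K` at `y`.
      K-hom = homogeneous N₁ small₁ u (h ∘ₑ i₁) su (∘-strong h i₁ sh si₁)
      G-hom = homogeneous N₁ small₁ u (h ∘ₑ i₂) su (∘-strong h i₂ sh si₂)

      K G : Aut 𝕄
      K = proj₁ K-hom
      G = proj₁ G-hom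

      Gx≈Ky : ∀ i → ⟨ G ⟩ (x i) M.≈ ⟨ K ⟩ (y i)
      Gx≈Ky i
        with nx , unx ← xy∈u (i ↑ˡ k)
        with ny , uny ← xy∈u (k ↑ʳ i)
        = M.trans (Embedding.cong (proj₁ G) (M.sym ux))
            (M.trans (proj₂ G-hom nx)
              (M.trans (Embedding.cong h i₂nx≈i₁ny)
                (M.trans (M.sym (proj₂ K-hom ny)) (Embedding.cong (proj₁ K) uy))))
        where
        ux : to u nx M.≈ x i
        ux = M.trans unx (M.reflexive (lookup-++ˡ x y i))

        uy : to u ny M.≈ y i
        uy = M.trans uny (M.reflexive (lookup-++ʳ x y i))

        i₂nx≈i₁ny : Structure._≈_ N₂ (to i₂ nx) (to i₁ ny)
        i₂nx≈i₁ny = Embedding.injective v (M′.trans (vi₂ nx)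
          (M′.trans (Embedding.cong (proj₁ F ∘ₑ ι) ux)
            (M′.trans (Fx≈y i) (M′.trans (Embedding.cong ι (M.sym uy)) (M′.sym (vi₁ ny))))))

    ι-++ : ∀ {k l} (u : Vector ∣ 𝕄 ∣ k) (v : Vector ∣ 𝕄 ∣ l) →
           T′.SameGalois ∅ (to ι ∘ (u ++ v)) ((to ι ∘ u) ++ (to ι ∘ v))
    ι-++ {k} u v = Galois.galois-≋ 𝕄′ λ i →
      M′.reflexive ([,]-∘ (to ι) (splitAt k i))

    descend-pair : ∀ {k l} {u u′ : Vector ∣ 𝕄 ∣ k} {v v′ : Vector ∣ 𝕄 ∣ l} →
                   T′.SameGalois ∅ [ to ι ∘ u , to ι ∘ v ]′ [ to ι ∘ u′ , to ι ∘ v′ ]′ →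
                   T.SameGalois ∅ [ u , v ]′ [ u′ , v′ ]′
    descend-pair {u = u} {u′} {v} {v′} uv≡u′v′ = Galois.++⇒pair 𝕄 (descend-galois
      (G′.galois-trans (ι-++ u v)
        (G′.galois-trans (G′.pair⇒++ uv≡u′v′) (G′.galois-sym (ι-++ u′ v′)))))
      where module G′ = Galois 𝕄′

-- Restricting automorphisms of 𝕄ᵉ to the home sort.

module Imaginary {σ} (𝕄 : Structure σ) (ℰ : ImaginarySorts 𝕄) where
  open Structure 𝕄 hiding (Carrier) renaming (refl to ≈-refl; sym to ≈-sym; trans to ≈-trans)
  open Eq 𝕄 ℰ
  open Setoid domainᵉ using () renaming (refl to ∼-refl; sym to ∼-sym)
  open Embedding using (injective; rel-hom) renaming (cong to to-cong)

  home-cong : ∀ {x y} → x ≈ y → home x ∼ home y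
  home-cong x≈y = class λ { zero → x≈y }

  home-injective : ∀ {x y} → home x ∼ home y → x ≈ y
  home-injective (class x≋y) = x≋y zero

  IsHome : Carrierᵉ → Set
  IsHome z = ∃ λ x → home x ∼ z

  P⇒home : ∀ {v} → ⟦ P nothing ⟧ᵉ v → IsHome (v zero)
  P⇒home (x , p) = x zero , ∼-trans (class λ { zero → ≈-refl }) (p zero)

  home⇒P : ∀ {v} → IsHome (v zero) → ⟦ P nothing ⟧ᵉ v
  home⇒P (x , p) = x ∷ [] , λ { zero → p }

  preserves-home : (f : Aut 𝕄ᵉ) → ∀ x → IsHome (⟨ f ⟩ (home x))
  preserves-home (f , _) x =
    P⇒home (Equivalence.to (rel-hom f (P nothing) (home x ∷ [])) (home⇒P (x , ∼-refl)))

  reflects-home : (f : Aut 𝕄ᵉ) → ∀ z → IsHome (⟨ f ⟩ z) → IsHome z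
  reflects-home (f , _) z h =
    P⇒home (Equivalence.from (rel-hom f (P nothing) (z ∷ [])) (home⇒P h))

  module _ (f : Aut 𝕄ᵉ) where
    private
      r : ∣ 𝕄 ∣ → ∣ 𝕄 ∣
      r x = proj₁ (preserves-home f x)

      r-home : ∀ x → home (r x) ∼ ⟨ f ⟩ (home x)
      r-home x = proj₂ (preserves-home f x)

      to-r : ∀ {x y} → home y ∼ ⟨ f ⟩ (home x) → y ≈ r x
      to-r p = home-injective (∼-trans p (∼-sym (r-home _)))

      r-cong : ∀ {x y} → x ≈ y → r x ≈ r y
      r-cong p = to-r (∼-trans (r-home _) (to-cong (proj₁ f) (home-cong p)))

      r-injective : ∀ {x y} → r x ≈ r y → x ≈ y
      r-injective p = home-injective (injective (proj₁ f)
        (∼-trans (∼-sym (r-home _)) (∼-trans (home-cong p) (r-home _))))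

    -- The predicate `P nothing` makes the home sort invariant in both directions, which yields the
    -- map and its surjectivity. Functions of 𝕄 are preserved because their graphs are relations of
    -- 𝕄ᵉ.
    restrict : Aut 𝕄
    restrict = record
      { to        = r
      ; cong      = r-cong
      ; injective = r-injective
      ; fun-hom   = λ F x →
          let y , p = Equivalence.to (rel-hom (proj₁ f) (funᵉ F) (home (fun F x) ∷ (home ∘ x)))
                        (x , λ _ → ∼-refl)
          in ≈-trans (≈-sym (to-r (p zero))) (fun-cong F λ i → to-r (p (suc i)))
      ; rel-hom   = λ R x → mk⇔
          (λ Rx → let y , p , Ry = Equivalence.to (rel-hom (proj₁ f) (relᵉ R) (home ∘ x))
                                     (x , (λ _ → ∼-refl) , Rx)
                  in rel-resp R (λ i → to-r (p i)) Ry)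
          (λ Rrx → let y , p , Ry = Equivalence.from (rel-hom (proj₁ f) (relᵉ R) (home ∘ x))
                                      ((r ∘ x) , (λ i → r-home (x i)) , Rrx)
                   in rel-resp R (λ i → home-injective (p i)) Ry)
      } , λ y →
        let z , fz∼y   = proj₂ f (home y)
            x , x∼z = reflects-home f z (y , ∼-sym fz∼y)
        in x , home-injective (∼-trans (r-home x) (∼-trans (to-cong (proj₁ f) x∼z) fz∼y))

    restrict-home : ∀ x → home (⟨ restrict ⟩ x) ∼ ⟨ f ⟩ (home x)
    restrict-home = r-home

-- Counting Lascar types over `A`.

module Counting
  (em : ∀ {ℓ} → ExcludedMiddle ℓ) (ext : ∀ {ℓ₁ ℓ₂} → Extensionality ℓ₁ ℓ₂)
  {σ : Signature} (𝕂 : AEC σ) (δ : Setoid 0ℓ 0ℓ) (inaccessible : StronglyInaccessible δ)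
  (𝕄 : Structure σ) (monster : IsMonster 𝕂 δ 𝕄) (fur : FUR.IsFUR 𝕂 δ 𝕄)
  (𝕊 : Supermonster 𝕂 𝕄) (A : List ∣ 𝕄 ∣) where

  open Supermonster 𝕊
  open Classical em ext
  open Cardinal δ inaccessible
  open Hull em ext δ inaccessible 𝕂
  open Extension 𝕄 monster 𝕊
  open FUR 𝕂 δ 𝕄 using (Model; Countable)
  open FUR.IsFUR fur using (AI)
  private
    module M  = Structure 𝕄
    module M′ = Structure 𝕄′
    module T  = Types 𝕄
    module T′ = Types 𝕄′
    module G  = Galois 𝕄
    module G′ = Galois 𝕄′
    module L′ = Lascar 𝕄′ δ (dom 𝕄′)
    module E  = L′.InvariantEquivalence

    ι-cong : ∀ {x y} → x M.≈ y → to ι x M′.≈ to ι y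
    ι-cong = Embedding.cong ι

  ιA : List ∣ 𝕄′ ∣
  ιA = map (to ι) A

  ∈-ι⁺ : ∀ {x xs} → x ∈ T.⟦ xs ⟧ → to ι x ∈ T′.⟦ map (to ι) xs ⟧
  ∈-ι⁺ = Mem.∈-map⁺ M.domain M′.domain ι-cong

  ∈-ι⁻ : ∀ {y} xs → y ∈ T′.⟦ map (to ι) xs ⟧ → ∃ λ x → x ∈ T.⟦ xs ⟧ × y M′.≈ to ι x
  ∈-ι⁻ xs = Mem.∈-map⁻ M.domain M′.domain

  module _ where
    private
      hullA = countableHull (IsMonster.inClass monster) (lookup A)

    𝒜 : Model
    𝒜 = record
      { struct  = proj₁ hullA
      ; incl    = proj₁ (proj₂ hullA)
      ; strong  = proj₁ (proj₂ (proj₂ hullA))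
      ; bounded = small-≲ (proj₂ (proj₂ (proj₂ (proj₂ hullA)))) small-ω
      }

    𝒜-countable : Countable 𝒜
    𝒜-countable = proj₂ (proj₂ (proj₂ (proj₂ hullA)))

    A⊆𝒜 : All (Model.set 𝒜) A
    A⊆𝒜 = All.tabulateₛ M.domain λ x∈ →
      let i , Ai≈x = G.⟦⟧⊆range A x∈ ; y , y≈ = proj₁ (proj₂ (proj₂ (proj₂ hullA))) i
      in y , M.trans y≈ Ai≈x

  -- By s-saturation (`AI`) the tuples of one countable model represent all types over `A` of finite
  -- tuples; this keeps the later codes small.
  realize : ∀ {m} (b : Vector ∣ 𝕄 ∣ m) →
            ∃ λ a → a T.⊂∈ Model.set 𝒜 × T.SameGalois T.⟦ A ⟧ a b
  realize b = let a , a∈ , t = AI 𝒜 𝒜-countable b A A⊆𝒜 in a , a∈ , G.type⇒galois A t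

  Tuples : ℕ → Setoid 0ℓ 0ℓ
  Tuples m = sub (M.≋-setoid m) (T._⊂∈ Model.set 𝒜)

  small-Tuples : ∀ m → Small (Tuples m)
  small-Tuples m = small-Π (small-Fin m) (λ _ → Model.bounded 𝒜) (λ i (_ , x∈) → proj₁ (x∈ i))
    λ { {x , x∈} {y , y∈} e i →
      subst (λ j → x j M.≈ y j) (rep-≈ (setoid (Fin m)) i)
        (M.trans (M.sym (proj₂ (x∈ _)))
          (M.trans (Embedding.cong (Model.incl 𝒜) (e i)) (proj₂ (y∈ _)))) }

  BoundedInvariant : ℕ → Set₁
  BoundedInvariant k = ∃ λ A₁ → All T′.⟦ ιA ⟧ A₁ × L′.InvariantEquivalence T′.⟦ A₁ ⟧ k

  fixes-⊆ : ∀ {A₁} → All T′.⟦ ιA ⟧ A₁ → (F : Aut 𝕄′) → T′.Fixes T′.⟦ ιA ⟧ F → T′.Fixes T′.⟦ A₁ ⟧ F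
  fixes-⊆ A₁⊆ F fix x x∈ = fix x (All.lookupₛ M′.domain (Mem.∈-resp-≈ M′.domain) A₁⊆ x∈)

  module _ {k : ℕ} where
    Holds : BoundedInvariant k → Vector ∣ 𝕄′ ∣ k → Vector ∣ 𝕄′ ∣ k → Set
    Holds (_ , _ , e) = E.E e

    holds-galois : ∀ e (F : Aut 𝕄′) → T′.Fixes T′.⟦ ιA ⟧ F → ∀ {u v u′ v′} →
                   (∀ i → ⟨ F ⟩ (u i) M′.≈ u′ i) → (∀ i → ⟨ F ⟩ (v i) M′.≈ v′ i) →
                   Holds e u v → Holds e u′ v′
    holds-galois (A₁ , A₁⊆ , e) F fix {u} {v} {u′} {v′} Fu Fv uv =
      ≈.trans (≈.sym (E.resp e Fu)) (≈.trans (E.invariant e F (fixes-⊆ A₁⊆ F fix) uv) (E.resp e Fv))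
      where module ≈ = Setoid (E.classes e)

    HoldsOn : BoundedInvariant k → Vector ∣ 𝕄 ∣ (k + k) → Set
    HoldsOn e x = Holds e (λ i → to ι (x (i ↑ˡ k))) (λ i → to ι (x (k ↑ʳ i)))

    trace : BoundedInvariant k → Func (Tuples (k + k)) (setoid Bool)
    trace e = pred (Tuples (k + k)) (HoldsOn e ∘ proj₁) λ x≋y →
      holds-galois e idₐ (λ _ _ → M′.refl) (λ i → ι-cong (x≋y _)) (λ i → ι-cong (x≋y _))

    -- Invariance over `A` makes the truth of a relation at `(c , d)` depend only on the type over
    -- `A` of the concatenation, and some tuple of `𝒜` has that type.
    trace-determines : ∀ e e′ → (∀ x → Func.to (trace e) x ≡ Func.to (trace e′) x) →
                       ∀ (c d : Vector ∣ 𝕄 ∣ k) →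
                       Holds e (to ι ∘ c) (to ι ∘ d) → Holds e′ (to ι ∘ c) (to ι ∘ d)
    trace-determines e e′ eq c d cd
      with x , x∈ , x≡cd ← realize (c ++ d)
      with F , fix , Fx ← lift-galois (∈-ι⁻ A) x≡cd
      = holds-galois e′ F fix Fxˡ Fxʳ (isYes-cong⁻ (eq (x , x∈))
          (holds-galois e (F ⁻¹) (G′.fixes-⁻¹ F fix) (inverted ∘ Fxˡ) (inverted ∘ Fxʳ) cd))
      where
      Fxˡ : ∀ i → ⟨ F ⟩ (to ι (x (i ↑ˡ k))) M′.≈ to ι (c i)
      Fxˡ i = M′.trans (Fx (i ↑ˡ k)) (ι-cong (M.reflexive (lookup-++ˡ c d i)))

      Fxʳ : ∀ i → ⟨ F ⟩ (to ι (x (k ↑ʳ i))) M′.≈ to ι (d i)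
      Fxʳ i = M′.trans (Fx (k ↑ʳ i)) (ι-cong (M.reflexive (lookup-++ʳ c d i)))

      inverted : ∀ {y z} → ⟨ F ⟩ y M′.≈ z → ⟨ F ⁻¹ ⟩ z M′.≈ y
      inverted Fy≈z = Embedding.injective (proj₁ F) (M′.trans (inverseʳ F _) (M′.sym Fy≈z))

  SameLascarᵗ : ∀ {k} (u v : Vector ∣ 𝕄′ ∣ k) → Set₁
  SameLascarᵗ = L′.SameLascar T′.⟦ ιA ⟧

  LascarTypes : ℕ → Setoid 0ℓ 0ℓ
  LascarTypes k = record
    { Carrier       = Vector ∣ 𝕄 ∣ k
    ; _≈_           = λ c d → Resized (SameLascarᵗ (to ι ∘ c) (to ι ∘ d))
    ; isEquivalence = record
      { refl  = resize λ A₁ A₁⊆ e → Setoid.refl (E.classes e)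
      ; sym   = λ p → resize λ A₁ A₁⊆ e → Setoid.sym (E.classes e) (unresize p A₁ A₁⊆ e)
      ; trans = λ p q → resize λ A₁ A₁⊆ e →
          Setoid.trans (E.classes e) (unresize p A₁ A₁⊆ e) (unresize q A₁ A₁⊆ e)
      }
    }

  -- A Lascar type is determined by its classes under one chosen relation per trace: relations with
  -- the same trace agree on 𝕄. The relations form a large type, but their traces form a small set
  -- that can index the product.
  small-LascarTypes : ∀ k → Small (LascarTypes k)
  small-LascarTypes k = small-Π small-Traces (λ s → E.bounded (proj₂ (proj₂ (relation s))))
      (λ _ c → to ι ∘ c) λ {c} {d} h → resize λ A₁ A₁⊆ e →
        let e⁺ = A₁ , A₁⊆ , e
            s  = trace e⁺ , resize (e⁺ , λ _ → refl)
        in trace-determines (relation (rep Traces s)) e⁺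
             (λ x → trans (proj₂ (unresize (proj₂ (rep Traces s))) x) (rep-≈ Traces s x))
             c d (h s)
    where
    Traces : Setoid 0ℓ 0ℓ
    Traces = sub (𝒫 (Tuples (k + k))) λ s →
      Resized (∃ λ (e : BoundedInvariant k) → ∀ x → Func.to (trace e) x ≡ Func.to s x)

    small-Traces : Small Traces
    small-Traces = small-⊑ (reflecting proj₁ λ e → e) (small-𝒫 (small-Tuples (k + k)))

    relation : Carrier Traces → BoundedInvariant k
    relation (_ , w) = proj₁ (unresize w)

  lascar-image : (F : Aut 𝕄′) → T′.Fixes T′.⟦ ιA ⟧ F → ∀ {k} {u v u′ v′ : Vector ∣ 𝕄′ ∣ k} →
                 (∀ i → ⟨ F ⟩ (u i) M′.≈ u′ i) → (∀ i → ⟨ F ⟩ (v i) M′.≈ v′ i) →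
                 SameLascarᵗ u v → SameLascarᵗ u′ v′
  lascar-image F fix Fu Fv uv A₁ A₁⊆ e = holds-galois (A₁ , A₁⊆ , e) F fix Fu Fv (uv A₁ A₁⊆ e)

  -- Makes the copy of 𝕄 an admissible test set `D` in the definition of independence.
  image≺𝕄′ : sub (dom 𝕄′) (image ι) ≺ dom 𝕄′
  image≺𝕄′ = ⊑⇒≲ (reflecting proj₁ id) , λ g → proj₂ larger (⊑⇒≲ (reflecting
    (λ z → proj₁ (proj₂ (Injection.to g z)))
    λ {z} {z′} e → Injection.injective g
      (M′.trans (M′.sym (proj₂ (proj₂ (Injection.to g z))))
        (M′.trans (ι-cong e) (proj₂ (proj₂ (Injection.to g z′)))))))

  -- Independence tested on 𝕄 yields `b*` with the type of `b` over 𝕄 that does not Lascar split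
  -- over a finite part of `A`. The conclusion holds for `b*` and is carried back to `b`.
  independent⇒lascar-invariant :
    ∀ {n} (b : Vector ∣ 𝕄′ ∣ n) → b L′.↓[ T′.⟦ ιA ⟧ ] image ι →
    ∀ {k} (c d : Vector ∣ 𝕄 ∣ k) → SameLascarᵗ (to ι ∘ c) (to ι ∘ d) →
    T′.SameGalois ∅ (b ++ (to ι ∘ c)) (b ++ (to ι ∘ d))
  independent⇒lascar-invariant b (A₀ , A₀⊆ , extend) {k} c d c~d
    with b* , b*≡b , ns ← extend (image ι)
           image≺𝕄′
           (λ { (inj₁ x∈) → let y , _ , x≈ = ∈-ι⁻ A x∈ in y , M′.sym x≈
              ; (inj₂ x∈) → x∈ })
    = G′.galois-trans (G′.galois-sym (move c)) (G′.galois-trans nonsplitting (move d))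
    where
    move : ∀ (e : Vector ∣ 𝕄 ∣ k) → T′.SameGalois ∅ (b* ++ (to ι ∘ e)) (b ++ (to ι ∘ e))
    move e = G′.pair⇒++ (G′.fixing⇒pair {w = to ι ∘ e} (λ i → Mem.∈-tabulate⁺ M′.domain i)
      (b*≡b (toList (to ι ∘ e)) (All.tabulateₛ M′.domain λ x∈ →
        let i , x≈ = Mem.∈-tabulate⁻ M′.domain x∈ in inj₂ (e i , M′.sym x≈))))

    nonsplitting : T′.SameGalois ∅ (b* ++ (to ι ∘ c)) (b* ++ (to ι ∘ d))
    nonsplitting = G′.galois-∅ (G′.type⇒galois A₀ (dne λ ≢ →
      ns (k , to ι ∘ c , to ι ∘ d , (λ i → c i , M′.refl) , (λ i → d i , M′.refl) ,
          (λ A₁ A₁⊆ e → c~d A₁ (All.map (All.lookupₛ M′.domain (Mem.∈-resp-≈ M′.domain) A₀⊆) A₁⊆) e) ,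
          ≢)))

  -- Coding the conjugates of the global type over `A`.

  module Conjugates {n} (p : Global.GlobalType 𝕂 δ 𝕄 𝕊 n) (b : Vector ∣ 𝕄′ ∣ n)
                    (p-typeOf-b : Global.GlobalType.RealizedBy p b)
                    (independent : b L′.↓[ T′.⟦ ιA ⟧ ] image ι) where
    open Global 𝕂 δ 𝕄 𝕊 using (Preserves; module GlobalType)
    open GlobalType p using () renaming (rep to repₚ)

    Describes : Aut 𝕄 → ∀ {k} → Vector ∣ 𝕄 ∣ k → Vector ∣ 𝕄 ∣ (n + k) → Set
    Describes h c x = T′.SameGalois ∅ (b ++ (to ι ∘ ⟨ h ⟩ ∘ c)) (to ι ∘ x)

    -- The lift of `h` to 𝕄′ fixes `A`, hence preserves Lascar equivalence over `A`; invariance of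
    -- `b` then applies to the images of `c` and `d`.
    describes-resp : ∀ h → T.Fixes T.⟦ A ⟧ h → ∀ {k} {c d : Vector ∣ 𝕄 ∣ k} {x y} →
                     SameLascarᵗ (to ι ∘ c) (to ι ∘ d) → x M.≋ y →
                     Describes h c x → Describes h d y
    describes-resp h fix {c = c} {d} c~d x≋y hcx with H , Hι ← lift h =
      G′.galois-trans
        (independent⇒lascar-invariant b independent (⟨ h ⟩ ∘ d) (⟨ h ⟩ ∘ c)
          (lascar-image H H-fixes (λ i → Hι (d i)) (λ i → Hι (c i))
            (λ A₁ A₁⊆ e → Setoid.sym (E.classes e) (c~d A₁ A₁⊆ e))))
        (G′.galois-trans hcx (G′.galois-≋ λ i → ι-cong (x≋y i)))
      where
      H-fixes : T′.Fixes T′.⟦ ιA ⟧ H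
      H-fixes z z∈ = let x , x∈ , z≈ = ∈-ι⁻ A z∈ in
        M′.trans (Embedding.cong (proj₁ H) z≈) (M′.trans (Hι x)
          (M′.trans (ι-cong (fix x x∈)) (M′.sym z≈)))

    Descriptions : ℕ → Setoid 0ℓ 0ℓ
    Descriptions k = 𝒫 (LascarTypes k ×ₛ Tuples (n + k))

    small-Descriptions : ∀ k → Small (Descriptions k)
    small-Descriptions k = small-𝒫 (small-× (small-LascarTypes k) (small-Tuples (n + k)))

    -- Codes the conjugate of p under h⁻¹.
    describe : ∀ h → T.Fixes T.⟦ A ⟧ h → ∀ k → Carrier (Descriptions k)
    describe h fix k = pred (LascarTypes k ×ₛ Tuples (n + k)) (λ (c , x , _) → Describes h c x)
      λ (c~d , x≋y) → describes-resp h fix (unresize c~d) x≋y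

    -- The representative of `p` over `c` lies in 𝕄, so together with `c` it realizes the type in
    -- question inside 𝕄, and s-saturation moves this pair into `𝒜`.
    realized-in-𝒜 : ∀ {k} (c : Vector ∣ 𝕄 ∣ k) →
                    ∃ λ x → x T.⊂∈ Model.set 𝒜 × T′.SameGalois ∅ (b ++ (to ι ∘ c)) (to ι ∘ x)
    realized-in-𝒜 {k} c =
      let x , x∈ , x≡ = realize (p-c ++ c)
      in x , x∈ , G′.galois-trans
           (G′.galois-sym (G′.galois-trans (ι-++ p-c c) (G′.pair⇒++ rep≡b)))
           (G′.galois-sym (lift-galois-∅ (G.galois-∅ x≡)))
      where
      p-c : Vector ∣ 𝕄 ∣ n
      p-c = repₚ (toList c)

      rep≡b : T′.SameGalois ∅ [ to ι ∘ p-c , to ι ∘ c ]′ [ b , to ι ∘ c ]′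
      rep≡b = G′.fixing⇒pair (λ i → ∈-ι⁺ (Mem.∈-tabulate⁺ M.domain i)) (p-typeOf-b (toList c))

    describe-determines : ∀ h h′ fix fix′ {k} →
      (∀ z → Func.to (describe h fix k) z ≡ Func.to (describe h′ fix′ k) z) →
      ∀ (c : Vector ∣ 𝕄 ∣ k) →
      T′.SameGalois ∅ (b ++ (to ι ∘ ⟨ h ⟩ ∘ c)) (b ++ (to ι ∘ ⟨ h′ ⟩ ∘ c))
    describe-determines h h′ fix fix′ eq c =
      let x , x∈ , hcx = realized-in-𝒜 (⟨ h ⟩ ∘ c)
      in G′.galois-trans hcx (G′.galois-sym (isYes-cong⁻ (eq (c , x , x∈)) hcx))

    module _ (ℰ : ImaginarySorts 𝕄) where
      open Eq 𝕄 ℰ using (𝕄ᵉ; home; _∼_; domainᵉ; ∼-trans)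
      open Setoid domainᵉ using () renaming (sym to ∼-sym)
      open Imaginary 𝕄 ℰ
      private module Tᵉ = Types 𝕄ᵉ

      restrict-fixes : ∀ f → Tᵉ.Fixes Tᵉ.⟦ map home A ⟧ f → T.Fixes T.⟦ A ⟧ (restrict f)
      restrict-fixes f fix x x∈ = home-injective (∼-trans (restrict-home f x)
        (fix (home x) (Mem.∈-map⁺ M.domain domainᵉ home-cong x∈)))

      describeᵉ : ∀ f → Tᵉ.Fixes Tᵉ.⟦ map home A ⟧ f → ∀ k → Carrier (Descriptions k)
      describeᵉ f fix = describe (restrict f ⁻¹) (G.fixes-⁻¹ (restrict f) (restrict-fixes f fix))

      -- Equal descriptions say that the conjugates of `p` under `f` and `f′` coincide. Comparing
      -- them at the image of `B` under `f` relates `p` over `B` to `p` over the image of `B` under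
      -- `f′ ⁻¹ ∘ₐ f`.
      same-description⇒preserves : ∀ f f′ fix fix′ →
        (∀ k z → Func.to (describeᵉ f fix k) z ≡ Func.to (describeᵉ f′ fix′ k) z) →
        Preserves ℰ (f′ ⁻¹ ∘ₐ f) p
      same-description⇒preserves f f′ fix fix′ eq A₁ B (gB⊆A₁ , A₁⊆gB) c c′ B≡c gc∼c′ =
        G.pair⇒fixing A₁⊆ĝB (descend-pair chain)
        where
        f̂ f̂′ ĝ : Aut 𝕄
        f̂  = restrict f
        f̂′ = restrict f′
        ĝ  = f̂′ ⁻¹ ∘ₐ f̂

        -- Compatibility of restriction with this composite is checked after applying the injective
        -- `f′`.
        ĝ-home : ∀ x → home (⟨ ĝ ⟩ x) ∼ ⟨ f′ ⁻¹ ∘ₐ f ⟩ (home x)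
        ĝ-home x = Embedding.injective (proj₁ f′) (∼-trans (∼-sym (restrict-home f′ (⟨ ĝ ⟩ x)))
          (∼-trans (home-cong (inverseʳ f̂′ (⟨ f̂ ⟩ x)))
            (∼-trans (restrict-home f x) (∼-sym (inverseʳ f′ (⟨ f ⟩ (home x)))))))

        ĝc≈c′ : ∀ i → ⟨ ĝ ⟩ (c i) M.≈ c′ i
        ĝc≈c′ i = home-injective (∼-trans (ĝ-home (c i)) (gc∼c′ i))

        A₁⊆ĝB : T.⟦ A₁ ⟧ ⊆ T.range (⟨ ĝ ⟩ ∘ lookup B)
        A₁⊆ĝB x∈ =
          let y , y∈ , x∼gy = Mem.∈-map⁻ M.domain domainᵉ
                                (A₁⊆gB (Mem.∈-map⁺ M.domain domainᵉ home-cong x∈))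
              i , Bi≈y = G.⟦⟧⊆range B y∈
          in i , home-injective (∼-trans (home-cong (Embedding.cong (proj₁ ĝ) Bi≈y))
                   (∼-trans (ĝ-home y) (∼-sym x∼gy)))

        ĝB⊂A₁ : (to ι ∘ ⟨ ĝ ⟩ ∘ lookup B) T′.⊂∈ T′.⟦ map (to ι) A₁ ⟧
        ĝB⊂A₁ i =
          let x , x∈ , gBi∼x = Mem.∈-map⁻ M.domain domainᵉ
                (gB⊆A₁ (Mem.∈-map⁺ M.domain domainᵉ
                  (λ e → Embedding.cong (proj₁ (f′ ⁻¹ ∘ₐ f)) (home-cong e)) (G.lookup⊂∈ B i)))
          in ∈-ι⁺ (Mem.∈-resp-≈ M.domain
               (M.sym (home-injective (∼-trans (ĝ-home (lookup B i)) gBi∼x))) x∈)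

        ιB⊂ιB : (to ι ∘ lookup B) T′.⊂∈ T′.⟦ map (to ι) B ⟧
        ιB⊂ιB i = ∈-ι⁺ (G.lookup⊂∈ B i)

        ĝ-lift : Σ (Aut 𝕄′) λ F → ∀ x → ⟨ F ⟩ (to ι x) M′.≈ to ι (⟨ ĝ ⟩ x)
        ĝ-lift = lift ĝ

        conjugates-agree :
          T′.SameGalois ∅ (b ++ (to ι ∘ ⟨ f̂ ⁻¹ ⟩ ∘ ⟨ f̂ ⟩ ∘ lookup B))
                          (b ++ (to ι ∘ ⟨ ĝ ⟩ ∘ lookup B))
        conjugates-agree = describe-determines (f̂ ⁻¹) (f̂′ ⁻¹)
          (G.fixes-⁻¹ f̂ (restrict-fixes f fix)) (G.fixes-⁻¹ f̂′ (restrict-fixes f′ fix′))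
          (eq _) (⟨ f̂ ⟩ ∘ lookup B)

        chain : T′.SameGalois ∅ [ to ι ∘ repₚ A₁ , to ι ∘ ⟨ ĝ ⟩ ∘ lookup B ]′
                                [ to ι ∘ c′    , to ι ∘ ⟨ ĝ ⟩ ∘ lookup B ]′
        -- The path goes from the representative over `A₁` to `b`, then from the parameters `ĝ B`
        -- back to `B` by `conjugates-agree`, from `b` to the representative over `B`, on to `c`,
        -- and finally along `ĝ` to `c′`.
        chain =
          G′.galois-trans (G′.fixing⇒pair ĝB⊂A₁ (p-typeOf-b A₁))
          (G′.galois-trans (G′.galois-sym (G′.++⇒pair conjugates-agree))
          (G′.galois-trans (G′.galois-≋ λ where
            (inj₁ _) → M′.refl
            (inj₂ j) → ι-cong (inverseˡ f̂ (lookup B j)))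
          (G′.galois-trans (G′.galois-sym (G′.fixing⇒pair ιB⊂ιB (p-typeOf-b B)))
          (G′.galois-trans (G′.fixing⇒pair ιB⊂ιB (lift-galois (∈-ι⁻ B) B≡c))
            (proj₁ ĝ-lift , (λ _ ()) , λ where
              (inj₁ i) → M′.trans (proj₂ ĝ-lift (c i)) (ι-cong (ĝc≈c′ i))
              (inj₂ j) → proj₂ ĝ-lift (lookup B j))))))

lemma2p79 : (∀ {ℓ} → ExcludedMiddle ℓ) → (∀ {ℓ₁ ℓ₂} → Extensionality ℓ₁ ℓ₂) →
    ∀ {σ : Signature} (𝕂 : AEC σ) (δ : Setoid 0ℓ 0ℓ) → StronglyInaccessible δ →
    (𝕄 : Structure σ) → IsMonster 𝕂 δ 𝕄 → FUR.IsFUR 𝕂 δ 𝕄 →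
    (𝕊 : Supermonster 𝕂 𝕄) (ℰ : ImaginarySorts 𝕄) →
    Global.ContainsCanonicalRelations 𝕂 δ 𝕄 𝕊 ℰ →
    ∀ {n k} (a : Vector ∣ 𝕄 ∣ n) (A : List ∣ 𝕄 ∣) (α : Vector (Eq.Carrierᵉ 𝕄 ℰ) k) →
    Global.IsCb 𝕂 δ 𝕄 𝕊 ℰ α a A →
    Types._∈bcl[_]_ (Eq.𝕄ᵉ 𝕄 ℰ) α δ (Types.⟦_⟧ (Eq.𝕄ᵉ 𝕄 ℰ) (map (Eq.home 𝕄 ℰ) A))
lemma2p79 em ext 𝕂 δ inaccessible 𝕄 monster fur 𝕊 ℰ _ {n} {k} a A α cb =
  -- A realization `v` is coded by the descriptions, for all lengths `m`, of an automorphism that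
  -- carries `α` to `v`.
  small-Π small-ω small-Descriptions (λ m (v , t) → describeᵉ ℰ (aut t) (aut-fixes t) m)
    λ { {v , t} {v′ , t′} eq i →
      let f = aut t ; f′ = aut t′
          f′⁻¹fα∼α = Equivalence.to (canonicalBase (f′ ⁻¹ ∘ₐ f))
            (same-description⇒preserves ℰ f f′ (aut-fixes t) (aut-fixes t′) λ m z →
              -- Equality of codes is given at representatives of lengths only, hence the transport
              -- to `m`.
              subst (λ j → ∀ z → Func.to (describeᵉ ℰ f (aut-fixes t) j) z
                               ≡ Func.to (describeᵉ ℰ f′ (aut-fixes t′) j) z)
                    (rep-≈ ω m) (eq m) z)
      in ∼-trans (∼-sym (aut-maps t i)) (∼-trans (∼-sym (inverseʳ f′ (⟨ f ⟩ (α i))))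
           (∼-trans (Embedding.cong (proj₁ f′) (f′⁻¹fα∼α i)) (aut-maps t′ i))) }
  where
  open Eq 𝕄 ℰ using (𝕄ᵉ; home; domainᵉ; ∼-trans; _∼_)
  open Setoid domainᵉ using () renaming (sym to ∼-sym)
  open Classical em ext
  open Cardinal δ inaccessible
  open Global.IsCb cb
  open Counting em ext 𝕂 δ inaccessible 𝕄 monster fur 𝕊 A
  open Conjugates p b p-typeOf-b independent
  module Tᵉ = Types 𝕄ᵉ
  module Gᵉ = Galois 𝕄ᵉ

  -- Over the finite set `A` a weak type is a Galois type, so each realization comes with an
  -- automorphism fixing `A`.
  module _ {v : Vector (Eq.Carrierᵉ 𝕄 ℰ) k} (t : Tᵉ.SameType Tᵉ.⟦ map home A ⟧ α v) where
    aut : Aut 𝕄ᵉ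
    aut = proj₁ (Gᵉ.type⇒galois (map home A) t)

    aut-fixes : Tᵉ.Fixes Tᵉ.⟦ map home A ⟧ aut
    aut-fixes = proj₁ (proj₂ (Gᵉ.type⇒galois (map home A) t))

    aut-maps : ∀ i → ⟨ aut ⟩ (α i) ∼ v i
    aut-maps = proj₂ (proj₂ (Gᵉ.type⇒galois (map home A) t))
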